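{- If $\lambda$ is a self-conjugate (i.e. $\lambda=\lambda'$) wide partition with at most three distinct part sizes, then $\lambda$ is Latin.
   Context: For partitions $\alpha,\beta$ of the same integer, $\alpha\ge\beta$ (dominance) means $\sum_{k\le j}\alpha_k\ge\sum_{k\le j}\beta_k$ for all $j$; $\mu'$ is the conjugate of $\mu$. $\mu$ is a subpartition of $\lambda$ if the multiset of parts of $\mu$ is a submultiset of that of $\lambda$. $\lambda$ is wide if $\mu\ge\mu'$ for every subpartition $\mu$ of $\lambda$. A tableau of shape $\lambda$ is the Young diagram of $\lambda$ with a positive integer in each cell. $\lambda$ is Latin if there is a tableau of shape $\lambda$ in which no two cells in the same row or column have equal entries and in which, for every $i$, the integer $i$ occurs exactly $\lambda'_i$ times. -}

module Defs where

open import Data.Nat using (ℕ; zero; suc; _≤_; _<_; _≥_; _≤?_; _≟_; _⊔_)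
open import Data.List using (List; []; _∷_; length; filter; map; upTo; take; foldr; deduplicate; concatMap)
open import Data.Nat.ListAction using (sum)
open import Data.List.Relation.Unary.All using (All)
open import Data.List.Relation.Unary.Linked using (Linked)
open import Data.Product using (_×_; _,_; Σ)
open import Relation.Binary.PropositionalEquality using (_≡_; _≢_)

IsPartition : List ℕ → Set
IsPartition λ₀ = Linked _≥_ λ₀ × All (λ x → 0 < x) λ₀

-- number of parts of λ that are ≥ i ; for i ≥ 1 this is the conjugate part λ'_i
conjPart : List ℕ → ℕ → ℕ
conjPart λ₀ i = length (filter (λ x → i ≤? x) λ₀)

largest : List ℕ → ℕ
largest = foldr _⊔_ 0

conj : List ℕ → List ℕ
conj λ₀ = map (λ i → conjPart λ₀ (suc i)) (upTo (largest λ₀))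

partialSum : List ℕ → ℕ → ℕ
partialSum α j = sum (take j α)

_⊵_ : List ℕ → List ℕ → Set
α ⊵ β = ∀ j → partialSum β j ≤ partialSum α j

count : ℕ → List ℕ → ℕ
count v xs = length (filter (λ x → x ≟ v) xs)

IsSubpartition : List ℕ → List ℕ → Set
IsSubpartition μ λ₀ = IsPartition μ × (∀ v → count v μ ≤ count v λ₀)

Wide : List ℕ → Set
Wide λ₀ = ∀ μ → IsSubpartition μ λ₀ → μ ⊵ conj μ

distinctParts : List ℕ → ℕ
distinctParts λ₀ = length (deduplicate _≟_ λ₀)

-- cells (row, column), 0-indexed, of the Young diagram of λ
rowsFrom : ℕ → List ℕ → List (ℕ × ℕ)
rowsFrom r [] = []
rowsFrom r (x ∷ xs) = Data.List._++_ (map (λ c → r , c) (upTo x)) (rowsFrom (suc r) xs)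

cells : List ℕ → List (ℕ × ℕ)
cells = rowsFrom 0

_∈cells_ : ℕ × ℕ → List ℕ → Set
(r , c) ∈cells λ₀ = Data.List.Membership.Propositional._∈_ (r , c) (cells λ₀)
  where import Data.List.Membership.Propositional

-- a tableau assigns an integer to each cell (values off the diagram are irrelevant)
Tableau : Set
Tableau = ℕ → ℕ → ℕ

entryCount : List ℕ → Tableau → ℕ → ℕ
entryCount λ₀ T i = length (filter (λ rc → T (Data.Product.proj₁ rc) (Data.Product.proj₂ rc) ≟ i) (cells λ₀))

IsLatinTableau : List ℕ → Tableau → Set
IsLatinTableau λ₀ T =
  (∀ r c → (r , c) ∈cells λ₀ → 1 ≤ T r c) ×
  (∀ r c c' → (r , c) ∈cells λ₀ → (r , c') ∈cells λ₀ → c ≢ c' → T r c ≢ T r c') ×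
  (∀ r r' c → (r , c) ∈cells λ₀ → (r' , c) ∈cells λ₀ → r ≢ r' → T r c ≢ T r' c) ×
  (∀ i → 1 ≤ i → entryCount λ₀ T i ≡ conjPart λ₀ i)

Latin : List ℕ → Set
Latin λ₀ = Σ Tableau (IsLatinTableau λ₀)

{-# OPTIONS --safe #-}
module Submission where

-- A self-conjugate partition with at most three part sizes consists of a parts a + b + c, b parts
-- a + b and c parts a; split rows, columns and symbols into classes A, B, C of sizes a, b, c.
-- It is enough to make rows and columns distinct with the entries of row r at most λ_r.
-- Wideness gives c ≤ a and a (b + c) ≤ a² + b². With e = min(b, a − c), a = g + e + c and
-- b = e + f, the second inequality yields a f ≤ b². The block A × A is filled along its cyclic
-- diagonals: g of them carry symbols of A, given by a near-complete mapping of ℤ/a, e carry symbols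
-- of B and c carry those of C. Three applications of König's edge-colouring theorem, as in Ryser's
-- extension theorem for Latin rectangles, choose the B-symbols in A × A (so that a f ≤ b² bounds the
-- number of rows missing a given one by b), and then fill A × B and the rows of B. The blocks A × C
-- and C × A are again explicit.

import Data.Nat.Properties as ℕₚ
open import Data.Fin using (Fin; zero; suc; toℕ; fromℕ<; _↑ˡ_; combine; join; splitAt)
open import Data.Fin.Permutation.Components using (transpose; transpose-inverse)
open import Data.Fin.Properties using (any?; all?; injective⇒≤; +↔⊎; toℕ-injective; toℕ<n; toℕ-fromℕ<; ↑ˡ-injective; toℕ-combine; combine-injectiveˡ; toℕ-↑ˡ; fromℕ<-toℕ; toℕ-↑ʳ; join-splitAt) renaming (_≟_ to _≟ᶠ_)
open import Data.Fin.Subset using (Subset; _∈_; _∉_; _∪_; ⁅_⁆; ∣_∣)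
open import Data.Fin.Subset.Properties using (_∈?_; p⊂q⇒∣p∣<∣q∣; ∣p∣≤n; p⊆p∪q; q⊆p∪q; x∈p∪q⁻; x∈⁅x⁆; x∈⁅y⁆⇒x≡y)
open import Data.List using (List; []; _∷_; length; filter; map; upTo; replicate; _++_; applyUpTo; take; deduplicate)
open import Data.List.Membership.Propositional using () renaming (_∈_ to _∈ˡ_)
open import Data.List.Membership.Propositional.Properties using (∈-++⁻; ∈-map⁻; ∈-upTo⁻)
open import Data.List.Properties using (filter-++; length-++; map-applyUpTo; length-replicate; filter-none; filter-accept; filter-reject; map-upTo; filter-all; filter-complete; filter-idem; length-map; length-upTo; ++-identityʳ; ++-assoc)
open import Data.List.Relation.Unary.All as All using (All; []; _∷_)
open import Data.List.Relation.Unary.All.Properties using (applyUpTo⁺₁; ++⁺; ++⁻ʳ; replicate⁺; deduplicate⁺; all-filter)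
open import Data.List.Relation.Unary.Linked as Linked using (Linked; []; _∷_)
open import Data.List.Relation.Unary.Linked.Properties using (Linked⇒All)
open import Data.Maybe using (Maybe; just; nothing)
open import Data.Nat using (ℕ; zero; suc; _+_; _≤_; _<_; s≤s; _*_; _∸_; z≤n; NonZero; >-nonZero; _<?_; _/_; _%_; pred; _≤?_; _≟_; _≥_)
open import Data.Nat.DivMod using (_mod_; m%n<n; m≡m%n+[m/n]*n; /-mono-≤; %-distribˡ-+; m%n%n≡m%n; m<n*o⇒m/o<n; [m+n]%n≡m%n; m<n⇒m%n≡m)
open import Data.Nat.ListAction using (sum)
open import Data.Nat.Tactic.RingSolver using (solve-∀)
open import Data.Product using (Σ; ∃; _×_; _,_; proj₁; proj₂; ∃₂)
open import Data.Sum using (_⊎_; inj₁; inj₂)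
open import Data.Sum.Function.Propositional using (_⊎-↔_)
open import Data.Sum.Properties using (inj₁-injective; inj₂-injective; ≡-dec)
open import Defs
open import Function using (_∘_; id; _↔_; Inverse; mk↔ₛ′; flip)
open import Function.Construct.Composition using (_↔-∘_)
open import Function.Construct.Identity using (↔-id)
open import Function.Construct.Symmetry using (↔-sym)
open import Function.Definitions using (Injective)
open import Relation.Binary.Definitions using (DecidableEquality)
open import Relation.Binary.PropositionalEquality using (_≡_; _≢_; refl; sym; trans; cong; subst; cong₂; module ≡-Reasoning; subst₂)
open import Relation.Nullary using (Dec; yes; no; contradiction)
open import Relation.Nullary.Decidable using (¬?; _×-dec_; decidable-stable)
open import Relation.Unary using (Decidable)

open Inverse using (to; from; strictlyInverseˡ; strictlyInverseʳ)

-- Injections between finite sets.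

Inj : {X Y : Set} → (X → Y) → Set
Inj = Injective _≡_ _≡_

from-injective : {X Y : Set} (φ : X ↔ Y) → Inj (from φ)
from-injective φ {x} {y} eq =
  trans (sym (strictlyInverseˡ φ x)) (trans (cong (to φ) eq) (strictlyInverseˡ φ y))

to-injective : {X Y : Set} (φ : X ↔ Y) → Inj (to φ)
to-injective φ {x} {y} eq =
  trans (sym (strictlyInverseʳ φ x)) (trans (cong (from φ) eq) (strictlyInverseʳ φ y))

prepend : {m : ℕ} {Y : Set} → Y → (Fin m → Y) → Fin (suc m) → Y
prepend y f zero    = y
prepend y f (suc x) = f x

prepend-injective : {m : ℕ} {Y : Set} {y : Y} {f : Fin m → Y} →
  Inj f → (∀ x → f x ≢ y) → Inj (prepend y f)
prepend-injective f-inj y∉ {zero}  {zero}  eq = refl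
prepend-injective f-inj y∉ {zero}  {suc x} eq = contradiction (sym eq) (y∉ x)
prepend-injective f-inj y∉ {suc x} {zero}  eq = contradiction eq (y∉ x)
prepend-injective f-inj y∉ {suc x} {suc z} eq = cong suc (f-inj eq)

-- Pigeonhole: prepending a missed value to `f` would inject n + 1 elements into n.
endo-surjective : {n : ℕ} (f : Fin n → Fin n) → Inj f → ∀ y → ∃ λ x → f x ≡ y
endo-surjective {n} f f-inj y with any? (λ x → f x ≟ᶠ y)
... | yes hit = hit
... | no ¬hit =
  contradiction (injective⇒≤ (prepend-injective f-inj (λ x eq → ¬hit (x , eq)))) (ℕₚ.1+n≰n {n})

injective⇒↔ : {n : ℕ} {X Y : Set} → X ↔ Fin n → Y ↔ Fin n →
  (f : X → Y) → Inj f → Σ (X ↔ Y) λ φ → ∀ x → to φ x ≡ f x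
injective⇒↔ φX φY f f-inj = mk↔ₛ′ f g fg (λ x → f-inj (fg (f x))) , λ _ → refl
  where
  surj = endo-surjective (to φY ∘ f ∘ from φX) (from-injective φX ∘ f-inj ∘ to-injective φY)
  g = λ y → from φX (proj₁ (surj (to φY y)))
  fg = λ y → to-injective φY (proj₂ (surj (to φY y)))

missing-value : {m n : ℕ} (f : Fin m → Fin n) → m < n → ∃ λ y → ∀ x → f x ≢ y
missing-value {m} {n} f m<n with any? (λ y → all? (λ x → ¬? (f x ≟ᶠ y)))
... | yes miss = miss
... | no ¬miss = contradiction (injective⇒≤ g-inj) (ℕₚ.<⇒≱ m<n)
  where
  preimage : ∀ y → ∃ λ x → f x ≡ y
  preimage y with any? (λ x → f x ≟ᶠ y)
  ... | yes hit = hit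
  ... | no ¬hit = contradiction (y , λ x eq → ¬hit (x , eq)) ¬miss
  g-inj : Inj (proj₁ ∘ preimage)
  g-inj {y} {z} eq = trans (sym (proj₂ (preimage y))) (trans (cong f eq) (proj₂ (preimage z)))

-- Each round prepends one missed value; `shift` matches the resulting `zero` with the first element
-- of the second summand.
extend-injection : {m n : ℕ} (k : ℕ) → m + k ≡ n → (f : Fin m → Fin n) → Inj f →
  Σ (Fin m ⊎ Fin k → Fin n) λ F → Inj F × (∀ x → F (inj₁ x) ≡ f x)
extend-injection zero eq f f-inj = (λ { (inj₁ x) → f x }) , inj , λ _ → refl
  where
  inj : Inj _
  inj {inj₁ x} {inj₁ y} e = cong inj₁ (f-inj e)
extend-injection {m} {n} (suc k) eq f f-inj
  with y , y∉ ← missing-value f (subst (m <_) eq (ℕₚ.m<m+n m (s≤s z≤n)))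
  with F , F-inj , F-ext ← extend-injection k (trans (sym (ℕₚ.+-suc m k)) eq)
                             (prepend y f) (prepend-injective f-inj y∉)
  = F ∘ shift , shift-injective ∘ F-inj , F-ext ∘ suc
  where
  shift : Fin m ⊎ Fin (suc k) → Fin (suc m) ⊎ Fin k
  shift (inj₁ x)       = inj₁ (suc x)
  shift (inj₂ zero)    = inj₁ zero
  shift (inj₂ (suc x)) = inj₂ x
  shift-injective : Inj shift
  shift-injective {inj₁ _}       {inj₁ _}       refl = refl
  shift-injective {inj₁ _}       {inj₂ zero}    ()
  shift-injective {inj₁ _}       {inj₂ (suc _)} ()
  shift-injective {inj₂ zero}    {inj₂ zero}    refl = refl
  shift-injective {inj₂ (suc _)} {inj₂ (suc _)} refl = refl

abstract
  -- The `Fin k` summand enumerates the complement of the image of `f`. Below it names the symbols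
  -- missing from a column and the columns missing a symbol.
  extend-to-↔ : {m k : ℕ} {X Y : Set} → X ↔ Fin m → Y ↔ Fin (m + k) → (f : X → Y) → Inj f →
    Σ ((X ⊎ Fin k) ↔ Y) λ φ → ∀ x → to φ (inj₁ x) ≡ f x
  extend-to-↔ {m} {k} {X} {Y} φX φY f f-inj
    with F , F-inj , F-ext ← extend-injection k refl (to φY ∘ f ∘ from φX)
                               (from-injective φX ∘ f-inj ∘ to-injective φY)
    = proj₁ bij , λ x → trans (proj₂ bij (inj₁ x)) (F'-ext x)
    where
    index↔ : (X ⊎ Fin k) ↔ (Fin m ⊎ Fin k)
    index↔ = φX ⊎-↔ ↔-id _
    F' : X ⊎ Fin k → Y
    F' = from φY ∘ F ∘ to index↔
    F'-ext : ∀ x → F' (inj₁ x) ≡ f x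
    F'-ext x = trans (cong (from φY) (F-ext (to φX x)))
      (trans (strictlyInverseʳ φY _) (cong f (strictlyInverseʳ φX x)))
    bij : Σ ((X ⊎ Fin k) ↔ Y) λ φ → ∀ x → to φ x ≡ F' x
    bij = injective⇒↔ (↔-sym +↔⊎ ↔-∘ index↔) φY F' (to-injective index↔ ∘ F-inj ∘ from-injective φY)

-- Reachability in a finite directed graph.

module _ {r : ℕ} (H : Fin r → Fin r → Set) (H? : ∀ u v → Dec (H u v)) (root : Fin r) where

  -- A local condition, weaker than reachability by a path from `root`: a predecessor inside the set
  -- is all that the Kempe exchange asks for.
  Reached : Subset r → Set
  Reached P = ∀ {v} → v ∈ P → v ≡ root ⊎ ∃ λ u → u ∈ P × H u v

  Closed : Subset r → Set
  Closed P = ∀ {u v} → u ∈ P → H u v → v ∈ P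

  private
    -- `n` is fuel: every round adds a vertex to `P`, so `r < n + ∣ P ∣` persists, and at `n = 0` it
    -- contradicts `∣ P ∣ ≤ r`.
    close : ∀ n (P : Subset r) → r < n + ∣ P ∣ → root ∈ P → Reached P →
      ∃ λ Q → root ∈ Q × Reached Q × Closed Q
    close zero P r<∣P∣ _ _ = contradiction (∣p∣≤n P) (ℕₚ.<⇒≱ r<∣P∣)
    close (suc n) P r< root∈ reach
      with any? (λ u → any? (λ v → (u ∈? P) ×-dec ((¬? (v ∈? P)) ×-dec H? u v)))
    ... | no ¬exit = P , root∈ , reach ,
          λ {u} {v} u∈ h → decidable-stable (v ∈? P) (λ v∉ → ¬exit (u , v , u∈ , v∉ , h))
    ... | yes (u , v , u∈ , v∉ , h) = close n (P ∪ ⁅ v ⁆)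
          (ℕₚ.<-≤-trans r<
            (ℕₚ.≤-trans (ℕₚ.≤-reflexive (sym (ℕₚ.+-suc n ∣ P ∣)))
              (ℕₚ.+-monoʳ-≤ n (p⊂q⇒∣p∣<∣q∣ (old , v , new , v∉)))))
          (old root∈) reach'
      where
      old : ∀ {x} → x ∈ P → x ∈ P ∪ ⁅ v ⁆
      old = p⊆p∪q ⁅ v ⁆
      new : v ∈ P ∪ ⁅ v ⁆
      new = q⊆p∪q P ⁅ v ⁆ (x∈⁅x⁆ v)
      reach' : Reached (P ∪ ⁅ v ⁆)
      reach' {w} w∈ with x∈p∪q⁻ P ⁅ v ⁆ w∈
      ... | inj₂ w∈v = inj₂ (u , old u∈ , subst (H u) (sym (x∈⁅y⁆⇒x≡y v w∈v)) h)
      ... | inj₁ w∈P with reach w∈P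
      ...   | inj₁ eq            = inj₁ eq
      ...   | inj₂ (t , t∈ , h') = inj₂ (t , old t∈ , h')

  reachable-set : ∃ λ Q → root ∈ Q × Reached Q × Closed Q
  reachable-set = close (suc r) ⁅ root ⁆ (s≤s (ℕₚ.m≤m+n r _)) (x∈⁅x⁆ root) (inj₁ ∘ x∈⁅y⁆⇒x≡y root)

-- Bipartite edge-colouring by Kempe exchanges.

transpose-↔ : ∀ {n} → Fin n → Fin n → Fin n ↔ Fin n
transpose-↔ α β = mk↔ₛ′ (transpose α β) (transpose β α)
  (λ _ → transpose-inverse α β) (λ _ → transpose-inverse β α)

module _ {S : Set} (_≟ˢ_ : DecidableEquality S) {δ : ℕ} where

  -- A proper edge-colouring in array form: `to (π i) p` is the index of the edge of row `i` with
  -- colour `p`. Bijectivity makes it proper at the rows, so only the symbols remain to be checked.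
  Arrangement : {r : ℕ} → (Fin r → Fin δ → S) → (Fin r → Fin δ ↔ Fin δ) → Set
  Arrangement X π = ∀ p → Inj (λ i → X i (to (π i) p))

  module Insert {r : ℕ} (X : Fin (suc r) → Fin δ → S) (X-inj : ∀ i → Inj (X i))
    (label : Fin (suc r) → Fin δ → Fin δ)
    (label-inj : ∀ {i i' d d'} → X i d ≡ X i' d' → label i d ≡ label i' d' → i ≡ i') where

    -- Row `zero` is never permuted: its edge `p` is to receive colour `p`, and the older rows are
    -- recoloured until `k` reaches `δ`.
    Compatible : ℕ → (Fin r → Fin δ ↔ Fin δ) → Set
    Compatible k π = ∀ i p → toℕ p < k → X (suc i) (to (π i) p) ≢ X zero p

    module _ (α : Fin δ) (π : Fin r → Fin δ ↔ Fin δ) (arr : Arrangement (X ∘ suc) π) where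

      Y : Fin r → Fin δ → S
      Y i p = X (suc i) (to (π i) p)

      Y-inj : ∀ i → Inj (Y i)
      Y-inj i = to-injective (π i) ∘ X-inj (suc i)

      -- If `X zero α` met an old row in every colour, these δ occurrences and the one in row `zero`
      -- would carry δ + 1 distinct labels among δ.
      free-colour : ∃ λ β → ∀ i → Y i β ≢ X zero α
      free-colour with any? (λ β → all? (λ i → ¬? (Y i β ≟ˢ X zero α)))
      ... | yes free = free
      ... | no ¬free = contradiction
              (injective⇒≤ (prepend-injective labels-inj labels-new)) (ℕₚ.1+n≰n {δ})
        where
        row : ∀ β → ∃ λ i → Y i β ≡ X zero α
        row β with any? (λ i → Y i β ≟ˢ X zero α)
        ... | yes hit = hit
        ... | no ¬hit = contradiction (β , λ i eq → ¬hit (i , eq)) ¬free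
        labels : Fin δ → Fin δ
        labels β = label (suc (proj₁ (row β))) (to (π (proj₁ (row β))) β)
        labels-inj : Inj labels
        labels-inj {β} {γ} eq with row β | row γ
        ... | i , p | j , q with refl ← label-inj (trans p (sym q)) eq = Y-inj i (trans p (sym q))
        labels-new : ∀ β → labels β ≢ label zero α
        labels-new β eq with () ← label-inj (proj₂ (row β)) eq

      -- Kempe exchange: colours α and β are swapped along the alternating chain through `root`.
      module Swap (β : Fin δ) (β-free : ∀ i → Y i β ≢ X zero α)
        (root : Fin r) (root-α : Y root α ≡ X zero α) where

        -- Two edges of an alternating path at once: the β-edge of `u` and the α-edge of `v` meet in
        -- one symbol.
        H : Fin r → Fin r → Set
        H u v = Y v α ≡ Y u β

        chain = reachable-set H (λ u v → Y v α ≟ˢ Y u β) root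
        P      = proj₁ chain
        root∈  = proj₁ (proj₂ chain)
        reach  = proj₁ (proj₂ (proj₂ chain))
        closed = proj₂ (proj₂ (proj₂ chain))

        -- `P` is closed under predecessors too: `root` has none, because its α-symbol has no
        -- β-edge, and any other member has only one, because colour β is proper.
        backward : ∀ {u v} → v ∈ P → H u v → u ∈ P
        backward {u} v∈ h with reach v∈
        ... | inj₁ refl            = contradiction (trans (sym h) root-α) (β-free u)
        ... | inj₂ (w , w∈ , h') with refl ← arr β (trans (sym h) h') = w∈

        π' : Fin r → Fin δ ↔ Fin δ
        π' i with i ∈? P
        ... | yes _ = π i ↔-∘ transpose-↔ α β
        ... | no  _ = π i

        -- A clash in colour α or β between a swapped and an unswapped row would be a chain step
        -- leaving or entering `P`; the other colours are untouched.
        crossed : ∀ {i j} p → i ∈ P → j ∉ P → Y i (transpose α β p) ≢ Y j p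
        crossed {i} {j} p i∈ j∉ eq with p ≟ᶠ α
        ... | yes refl = j∉ (closed i∈ (sym eq))
        ... | no p≢α with p ≟ᶠ β
        ...   | yes refl = j∉ (backward i∈ eq)
        ...   | no p≢β = j∉ (subst (_∈ P) (arr p eq) i∈)

        arr' : Arrangement (X ∘ suc) π'
        arr' p {i} {j} eq with i ∈? P | j ∈? P
        ... | yes _  | yes _  = arr (transpose α β p) eq
        ... | no _   | no _   = arr p eq
        ... | yes i∈ | no j∉  = contradiction eq (crossed p i∈ j∉)
        ... | no i∉  | yes j∈ = contradiction (sym eq) (crossed p j∈ i∉)

        compatible' : Compatible (toℕ α) π → Compatible (suc (toℕ α)) π'
        compatible' comp i p p<1+α eq with i ∈? P
        compatible' comp i p p<1+α eq | no i∉ with ℕₚ.m≤n⇒m<n∨m≡n (ℕₚ.≤-pred p<1+α)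
        ... | inj₁ p<α = comp i p p<α eq
        -- The only row holding `X zero α` in colour α is `root`, which lies in `P`.
        ... | inj₂ p≡α with refl ← toℕ-injective p≡α =
          i∉ (subst (_∈ P) (arr p (trans root-α (sym eq))) root∈)
        compatible' comp i p p<1+α eq | yes i∈ with p ≟ᶠ α
        ... | yes refl = β-free i eq
        ... | no p≢α with ℕₚ.≤∧≢⇒< (ℕₚ.≤-pred p<1+α) (p≢α ∘ toℕ-injective)
        ...   | p<α with p ≟ᶠ β
        ...     | no p≢β = comp i p p<α eq
        -- Colour β now carries the old α-symbol of row `i`. At `root` this is `X zero α`, which
        -- differs from `X zero β`; elsewhere it is the β-symbol of the predecessor `u`, where the
        -- old compatibility applies.
        ...     | yes refl with reach i∈
        ...       | inj₁ refl         = p≢α (X-inj zero (trans (sym eq) root-α))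
        ...       | inj₂ (u , _ , h) = comp u p p<α (trans (sym h) eq)

    insert-upTo : ∀ k → k ≤ δ → ∃ (Arrangement (X ∘ suc)) → ∃ λ π → Arrangement (X ∘ suc) π × Compatible k π
    insert-upTo zero    _   (π , arr) = π , arr , λ _ _ ()
    insert-upTo (suc k) k<δ start with insert-upTo k (ℕₚ.<⇒≤ k<δ) start
    ... | π , arr , comp with any? (λ i → X (suc i) (to (π i) (fromℕ< k<δ)) ≟ˢ X zero (fromℕ< k<δ))
    ...   | yes (root , root-α) = π' , arr' , λ i p p<k → compatible' comp' i p (subst (toℕ p <_) (cong suc (sym k≡)) p<k)
      where
      k≡ = toℕ-fromℕ< k<δ
      open Swap (fromℕ< k<δ) π arr (proj₁ (free-colour _ π arr)) (proj₂ (free-colour _ π arr)) root root-α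
      comp' : Compatible (toℕ (fromℕ< k<δ)) π
      comp' = subst (λ k → Compatible k π) (sym k≡) comp
    ...   | no ¬clash = π , arr , comp'
      where
      comp' : Compatible (suc k) π
      comp' i p p<1+k eq with ℕₚ.m≤n⇒m<n∨m≡n (ℕₚ.≤-pred p<1+k)
      ... | inj₁ p<k = comp i p p<k eq
      ... | inj₂ refl = ¬clash (i , subst (λ p → X (suc i) (to (π i) p) ≡ X zero p) (toℕ-injective (sym (toℕ-fromℕ< k<δ))) eq)

  -- König's edge-colouring theorem for a bipartite graph on rows and symbols, positions being
  -- the colours; `label` witnesses that each symbol occurs at most δ times.
  rearrange : {r : ℕ} (X : Fin r → Fin δ → S) → (∀ i → Inj (X i)) →
    (label : Fin r → Fin δ → Fin δ) →
    (∀ {i i' d d'} → X i d ≡ X i' d' → label i d ≡ label i' d' → i ≡ i') →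
    ∃ (Arrangement X)
  rearrange {zero}  X X-inj label label-inj = (λ ()) , λ { p {()} }
  rearrange {suc r} X X-inj label label-inj
    with insert-upTo δ ℕₚ.≤-refl (rearrange (X ∘ suc) (X-inj ∘ suc) (label ∘ suc) tail-inj)
    where
    open Insert X X-inj label label-inj
    tail-inj : ∀ {i i' d d'} → X (suc i) d ≡ X (suc i') d' → label (suc i) d ≡ label (suc i') d' → i ≡ i'
    tail-inj eq eq' with refl ← label-inj eq eq' = refl
  ... | π , arr , comp = π⁺ , arr⁺
    where
    π⁺ : Fin (suc r) → Fin δ ↔ Fin δ
    π⁺ zero    = ↔-id _
    π⁺ (suc i) = π i
    arr⁺ : Arrangement X π⁺
    arr⁺ p {zero}  {zero}  eq = refl
    arr⁺ p {zero}  {suc j} eq = contradiction (sym eq) (comp j p (toℕ<n p))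
    arr⁺ p {suc i} {zero}  eq = contradiction eq (comp i p (toℕ<n p))
    arr⁺ p {suc i} {suc j} eq = cong suc (arr p eq)

record Colouring {I D S : Set} {δ : ℕ} (X : I → D → S) : Set where
  field
    bij      : I → Fin δ ↔ D
    distinct : ∀ {i i'} p → X i (to (bij i) p) ≡ X i' (to (bij i') p) → i ≡ i'

abstract
  colouring : {I D S : Set} {r δ : ℕ} → I ↔ Fin r → Fin δ ↔ D → DecidableEquality S →
    (X : I → D → S) → (∀ i → Inj (X i)) → (label : I → D → Fin δ) →
    (∀ {i i' d d'} → X i d ≡ X i' d' → label i d ≡ label i' d' → i ≡ i') → Colouring {δ = δ} X
  colouring φ ψ _≟_ X X-inj label label-inj
    with π , arr ← rearrange _≟_ (λ i p → X (from φ i) (to ψ p)) (λ i → to-injective ψ ∘ X-inj _)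
                     (λ i p → label (from φ i) (to ψ p)) (λ eq eq' → from-injective φ (label-inj eq eq'))
    = record
      { bij = λ i → ψ ↔-∘ π (to φ i)
      ; distinct = λ {i} {i'} p eq → to-injective φ (arr p (lemma i i' eq)) }
    where
    lemma : ∀ i i' {p p'} → X i p ≡ X i' p' → X (from φ (to φ i)) p ≡ X (from φ (to φ i')) p'
    lemma i i' eq = trans (cong (λ i → X i _) (strictlyInverseʳ φ i))
      (trans eq (sym (cong (λ i → X i _) (strictlyInverseʳ φ i'))))

-- Latin squares and the block form of a tableau.

record LatinSquare (A D : Set) : Set where
  field
    op    : A → D → A
    op-injˡ : ∀ i → Inj (op i)
    op-injʳ : ∀ d → Inj (λ i → op i d)
    ldiv  : A → A → D
    rdiv  : D → A → A
    op-ldiv : ∀ i j → op i (ldiv i j) ≡ j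
    op-rdiv : ∀ d j → op (rdiv d j) d ≡ j

  ldiv-op : ∀ i d → ldiv i (op i d) ≡ d
  ldiv-op i d = op-injˡ i (op-ldiv i (op i d))

  rdiv-op : ∀ d i → rdiv d (op i d) ≡ i
  rdiv-op d i = op-injʳ d (op-rdiv d (op i d))

-- A, B, C index the rows of lengths a + b + c, a + b and a, and equally the columns and the symbols.
record Blocks (A B C : Set) : Set where
  field
    rowA : A → (A ⊎ B) ⊎ C → (A ⊎ B) ⊎ C
    rowB : B → A ⊎ B → A ⊎ B
    rowC : C → A → A

  columnA : A → (A ⊎ B) ⊎ C → (A ⊎ B) ⊎ C
  columnA j (inj₁ (inj₁ i)) = rowA i (inj₁ (inj₁ j))
  columnA j (inj₁ (inj₂ p)) = inj₁ (rowB p (inj₁ j))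
  columnA j (inj₂ k)        = inj₁ (inj₁ (rowC k j))

  columnB : B → A ⊎ B → (A ⊎ B) ⊎ C
  columnB q (inj₁ i) = rowA i (inj₁ (inj₂ q))
  columnB q (inj₂ p) = inj₁ (rowB p (inj₂ q))

  columnC : C → A → (A ⊎ B) ⊎ C
  columnC k i = rowA i (inj₂ k)

record Filling (A B C : Set) : Set where
  field
    blocks : Blocks A B C
  open Blocks blocks public
  field
    rowA-inj : ∀ i → Inj (rowA i)
    rowB-inj : ∀ p → Inj (rowB p)
    rowC-inj : ∀ k → Inj (rowC k)
    columnA-inj : ∀ j → Inj (columnA j)
    columnB-inj : ∀ q → Inj (columnB q)
    columnC-inj : ∀ k → Inj (columnC k)

left-inverse⇒injective : {X Y : Set} {f : X → Y} (h : Y → X) → (∀ x → h (f x) ≡ x) → Inj f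
left-inverse⇒injective h hf {x} {y} eq = trans (sym (hf x)) (trans (cong h eq) (hf y))

-- The filling from three edge-colourings.

module Construction (g e c f : ℕ) where

  A B C D : Set
  A = Fin (g + (e + c))
  B = Fin (e + f)
  C = Fin c
  D = Fin g ⊎ (Fin e ⊎ Fin c)

  pattern inG x = inj₁ x
  pattern inE q = inj₂ (inj₁ q)
  pattern inC k = inj₂ (inj₂ k)

  D↔Fin : D ↔ Fin (g + (e + c))
  D↔Fin = ↔-sym +↔⊎ ↔-∘ (↔-id _ ⊎-↔ ↔-sym +↔⊎)

  -- `col.op i d` is the column of `A` where row `i` meets diagonal `d`. `σ.op i` distributes the
  -- A-symbols of row `i`: `inG` to the diagonals, `inE` to the columns of `B`, `inC` to those of
  -- `C`. `τ.op j` gives the A-symbols that column `j` receives on the G-diagonals and from the rows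
  -- of `C`; `agree` makes the two accounts of a G-diagonal coincide.
  module _ (col σ τ : LatinSquare A D)
    (agree : ∀ i x → LatinSquare.op τ (LatinSquare.op col i (inG x)) (inG x) ≡ LatinSquare.op σ i (inG x))
    (spread level : A → Fin f → B)
    (spread-inj : ∀ i → Inj (spread i))
    (level-inj : ∀ {i i' t t'} → spread i t ≡ spread i' t' → level i t ≡ level i' t' → i ≡ i')
    where

    module col = LatinSquare col
    module σ = LatinSquare σ
    module τ = LatinSquare τ

    _≟ᴬᴮ_ : (x y : A ⊎ B) → Dec (x ≡ y)
    _≟ᴬᴮ_ = ≡-dec _≟ᶠ_ _≟ᶠ_

    AB↔Fin : (A ⊎ B) ↔ Fin ((g + (e + c)) + (e + f))
    AB↔Fin = ↔-sym +↔⊎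

    -- X₁ i lists the columns where row i carries a symbol of B; the colours are these symbols.
    -- The columns in B only balance the colouring: the final ones come from the second colouring.
    X₁ : A → Fin e ⊎ Fin f → A ⊎ B
    X₁ i (inj₁ q) = inj₁ (col.op i (inE q))
    X₁ i (inj₂ t) = inj₂ (spread i t)

    X₁-inj : ∀ i → Inj (X₁ i)
    X₁-inj i {inj₁ q} {inj₁ q'} eq with refl ← col.op-injˡ i (inj₁-injective eq) = refl
    X₁-inj i {inj₂ t} {inj₂ t'} eq = cong inj₂ (spread-inj i (inj₂-injective eq))

    label₁ : A → Fin e ⊎ Fin f → B
    label₁ i (inj₁ q) = q ↑ˡ f
    label₁ i (inj₂ t) = level i t

    -- A column of `A` meets each of the `e` diagonals once; for a column of `B` the bound is the
    -- purpose of `level`.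
    label₁-inj : ∀ {i i' d d'} → X₁ i d ≡ X₁ i' d' → label₁ i d ≡ label₁ i' d' → i ≡ i'
    label₁-inj {d = inj₁ q} {inj₁ q'} eq eq'
      with refl ← ↑ˡ-injective f q q' eq' = col.op-injʳ (inE q) (inj₁-injective eq)
    label₁-inj {d = inj₂ t} {inj₂ t'} eq eq' = level-inj (inj₂-injective eq) eq'

    module K₁ = Colouring (colouring (↔-id A) +↔⊎ _≟ᴬᴮ_ X₁ X₁-inj label₁ label₁-inj)

    ρ₁ : A → Fin e ⊎ Fin f → B
    ρ₁ i = from (K₁.bij i)

    ρ₁-clash : ∀ {i i' d d'} → ρ₁ i d ≡ ρ₁ i' d' → X₁ i d ≡ X₁ i' d' → i ≡ i'
    ρ₁-clash {i} {i'} {d} {d'} eq eq' = K₁.distinct (ρ₁ i d)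
      (trans (cong (X₁ i) (strictlyInverseˡ (K₁.bij i) d))
        (trans eq' (cong (X₁ i') (sym (trans (cong (to (K₁.bij i')) eq) (strictlyInverseˡ (K₁.bij i') d'))))))

    -- X₂ i lists the symbols to be placed in row i and the columns of B; the colours are these columns.
    X₂ : A → Fin e ⊎ Fin f → A ⊎ B
    X₂ i (inj₁ q) = inj₁ (σ.op i (inE q))
    X₂ i (inj₂ t) = inj₂ (ρ₁ i (inj₂ t))

    X₂-inj : ∀ i → Inj (X₂ i)
    X₂-inj i {inj₁ q} {inj₁ q'} eq with refl ← σ.op-injˡ i (inj₁-injective eq) = refl
    X₂-inj i {inj₂ t} {inj₂ t'} eq = from-injective (K₁.bij i) (inj₂-injective eq)

    label₂ : A → Fin e ⊎ Fin f → B
    label₂ i (inj₁ q) = q ↑ˡ f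
    label₂ i (inj₂ t) = spread i t

    -- For a symbol of `B` the bound comes from the first colouring: that symbol is used at most
    -- once in each `spread` column, so this column can serve as the label.
    label₂-inj : ∀ {i i' d d'} → X₂ i d ≡ X₂ i' d' → label₂ i d ≡ label₂ i' d' → i ≡ i'
    label₂-inj {d = inj₁ q} {inj₁ q'} eq eq'
      with refl ← ↑ˡ-injective f q q' eq' = σ.op-injʳ (inE q) (inj₁-injective eq)
    label₂-inj {d = inj₂ t} {inj₂ t'} eq eq' = ρ₁-clash (inj₂-injective eq) (cong inj₂ eq')

    module K₂ = Colouring (colouring (↔-id A) +↔⊎ _≟ᴬᴮ_ X₂ X₂-inj label₂ label₂-inj)

    ρ₂ : A → Fin e ⊎ Fin f → B
    ρ₂ i = from (K₂.bij i)

    -- Rows outside `B` give `a` symbols of `A ⊎ B` to every such column: a column of `A` gets g + e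
    -- from the rows of `A` and c from those of `C`, a column of `B` gets one per row of `A`.
    -- Dually, the same type indexes the occurrences of a symbol.
    Slot : A ⊎ B → Set
    Slot (inj₁ _) = D
    Slot (inj₂ _) = A

    Slot↔Fin : ∀ x → Slot x ↔ Fin (g + (e + c))
    Slot↔Fin (inj₁ _) = D↔Fin
    Slot↔Fin (inj₂ _) = ↔-id _

    -- The symbols of A ⊎ B that column j receives from the rows in A and C.
    used : ∀ j → Slot j → A ⊎ B
    used (inj₁ j) (inG x) = inj₁ (τ.op j (inG x))
    used (inj₁ j) (inE q) = inj₂ (ρ₁ (col.rdiv (inE q) j) (inj₁ q))
    used (inj₁ j) (inC k) = inj₁ (τ.op j (inC k))
    used (inj₂ p) i       = X₂ i (to (K₂.bij i) p)

    used-inj : ∀ j → Inj (used j)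
    used-inj (inj₁ j) {inG x} {inG y} eq = τ.op-injˡ j (inj₁-injective eq)
    used-inj (inj₁ j) {inG x} {inC y} eq = τ.op-injˡ j (inj₁-injective eq)
    used-inj (inj₁ j) {inC x} {inG y} eq = τ.op-injˡ j (inj₁-injective eq)
    used-inj (inj₁ j) {inC x} {inC y} eq = τ.op-injˡ j (inj₁-injective eq)
    used-inj (inj₁ j) {inE q} {inE r} eq = col.op-injˡ _
      (trans (col.op-rdiv (inE q) j)
        (trans (sym (col.op-rdiv (inE r) j)) (cong (λ i → col.op i (inE r)) (sym same-row))))
      where
      same-row = ρ₁-clash (inj₂-injective eq)
        (cong inj₁ (trans (col.op-rdiv (inE q) j) (sym (col.op-rdiv (inE r) j))))
    used-inj (inj₂ p) eq = K₂.distinct p eq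

    used-ρ₂ : ∀ i d → used (inj₂ (ρ₂ i d)) i ≡ X₂ i d
    used-ρ₂ i d = cong (X₂ i) (strictlyInverseˡ (K₂.bij i) d)

    -- Columns of `A` stay as listed in `X₁`; a balancing column of `B` gives way to the one chosen
    -- by the second colouring.
    occurrence-in-row : A → Fin e ⊎ Fin f → A ⊎ B
    occurrence-in-row i (inj₁ q) = inj₁ (col.op i (inE q))
    occurrence-in-row i (inj₂ t) = inj₂ (ρ₂ i (inj₂ t))

    -- The dual of `used`: the columns of `A ⊎ B` where `s` occurs in rows of `A` and `C`. There are
    -- again `a` of them, so `s` is missing from `b` columns, the degree bound for the third
    -- colouring.
    occurrence : ∀ s → Slot s → A ⊎ B
    occurrence (inj₁ s) (inG x) = inj₁ (τ.rdiv (inG x) s)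
    occurrence (inj₁ s) (inE q) = inj₂ (ρ₂ (σ.rdiv (inE q) s) (inj₁ q))
    occurrence (inj₁ s) (inC k) = inj₁ (τ.rdiv (inC k) s)
    occurrence (inj₂ k) i       = occurrence-in-row i (to (K₁.bij i) k)

    used-occurrence : ∀ s x → ∃ λ y → used (occurrence s x) y ≡ s
    used-occurrence (inj₁ s) (inG x) = inG x , cong inj₁ (τ.op-rdiv (inG x) s)
    used-occurrence (inj₁ s) (inE q) = _ , trans (used-ρ₂ _ (inj₁ q)) (cong inj₁ (σ.op-rdiv (inE q) s))
    used-occurrence (inj₁ s) (inC k) = inC k , cong inj₁ (τ.op-rdiv (inC k) s)
    used-occurrence (inj₂ k) i with to (K₁.bij i) k | strictlyInverseʳ (K₁.bij i) k
    ... | inj₁ q | eq = inE q , cong inj₂ (trans (cong (λ i → ρ₁ i (inj₁ q)) (col.rdiv-op (inE q) i)) eq)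
    ... | inj₂ t | eq = i , trans (used-ρ₂ i (inj₂ t)) (cong inj₂ eq)

    τ-rdiv-clash : ∀ {d d' s} → τ.rdiv d s ≡ τ.rdiv d' s → d ≡ d'
    τ-rdiv-clash {d} {d'} {s} eq = τ.op-injˡ _
      (trans (τ.op-rdiv d s) (trans (sym (τ.op-rdiv d' s)) (cong (λ j → τ.op j d') (sym eq))))

    occurrence-inj : ∀ s → Inj (occurrence s)
    occurrence-inj (inj₁ s) {inG x} {inG y} eq = τ-rdiv-clash (inj₁-injective eq)
    occurrence-inj (inj₁ s) {inG x} {inC y} eq = τ-rdiv-clash (inj₁-injective eq)
    occurrence-inj (inj₁ s) {inC x} {inG y} eq = τ-rdiv-clash (inj₁-injective eq)
    occurrence-inj (inj₁ s) {inC x} {inC y} eq = τ-rdiv-clash (inj₁-injective eq)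
    occurrence-inj (inj₁ s) {inE q} {inE r} eq = σ.op-injˡ _
      (trans (σ.op-rdiv (inE q) s)
        (trans (sym (σ.op-rdiv (inE r) s)) (cong (λ i → σ.op i (inE r)) (sym same-row))))
      where
      same-row = used-inj (inj₂ _)
        (trans (proj₂ (used-occurrence (inj₁ s) (inE q)))
          (trans (sym (proj₂ (used-occurrence (inj₁ s) (inE r))))
            (cong (λ p → used (inj₂ p) _) (sym (inj₂-injective eq)))))
    occurrence-inj (inj₂ k) {i} {i'} eq
      with to (K₁.bij i) k in eq₁ | to (K₁.bij i') k in eq₂
    ... | inj₁ q | inj₁ q' = K₁.distinct k (trans (cong (X₁ i) eq₁) (trans eq (cong (X₁ i') (sym eq₂))))
    ... | inj₂ t | inj₂ t' = used-inj (inj₂ _)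
            (trans (used-ρ₂ i (inj₂ t)) (trans (cong inj₂ same-symbol)
              (trans (sym (used-ρ₂ i' (inj₂ t'))) (cong (λ p → used (inj₂ p) _) (sym (inj₂-injective eq))))))
      where
      same-symbol = trans (trans (cong (ρ₁ i) (sym eq₁)) (strictlyInverseʳ (K₁.bij i) k))
        (sym (trans (cong (ρ₁ i') (sym eq₂)) (strictlyInverseʳ (K₁.bij i') k)))

    symbols : ∀ j → Σ ((Slot j ⊎ B) ↔ (A ⊎ B)) λ φ → ∀ x → to φ (inj₁ x) ≡ used j x
    symbols j = extend-to-↔ (Slot↔Fin j) AB↔Fin (used j) (used-inj j)

    columns : ∀ s → Σ ((Slot s ⊎ B) ↔ (A ⊎ B)) λ φ → ∀ x → to φ (inj₁ x) ≡ occurrence s x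
    columns s = extend-to-↔ (Slot↔Fin s) AB↔Fin (occurrence s) (occurrence-inj s)

    symbols⁻¹-used : ∀ j x → from (proj₁ (symbols j)) (used j x) ≡ inj₁ x
    symbols⁻¹-used j x =
      trans (cong (from φ) (sym (proj₂ (symbols j) x))) (strictlyInverseʳ φ (inj₁ x))
      where φ = proj₁ (symbols j)

    -- X₃ j lists the symbols still missing from column j; the colours are the rows of B.
    X₃ : A ⊎ B → B → A ⊎ B
    X₃ j q = to (proj₁ (symbols j)) (inj₂ q)

    X₃-inj : ∀ j → Inj (X₃ j)
    X₃-inj j = inj₂-injective ∘ to-injective (proj₁ (symbols j))

    X₃-unused : ∀ j q x → used j x ≢ X₃ j q
    X₃-unused j q x eq with () ← to-injective (proj₁ (symbols j)) (trans (proj₂ (symbols j) x) eq)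

    -- The label is the index of `j` among the columns missing this symbol. The other case is
    -- impossible: an occurrence in column `j` would make the symbol `used` there.
    label₃ : ∀ j q → ∃ λ p → from (proj₁ (columns (X₃ j q))) j ≡ inj₂ p
    label₃ j q with from (proj₁ (columns (X₃ j q))) j in eq
    ... | inj₂ p = p , refl
    ... | inj₁ x = contradiction (subst (λ j' → Σ (Slot j') λ y → used j' y ≡ X₃ j q) j≡ (used-occurrence _ x))
                     (λ (y , eq') → X₃-unused j q y eq')
      where
      φ = proj₁ (columns (X₃ j q))
      j≡ : occurrence (X₃ j q) x ≡ j
      j≡ = trans (sym (proj₂ (columns (X₃ j q)) x)) (trans (cong (to φ) (sym eq)) (strictlyInverseˡ φ j))

    label₃-inj : ∀ {j j' q q'} → X₃ j q ≡ X₃ j' q' → proj₁ (label₃ j q) ≡ proj₁ (label₃ j' q') → j ≡ j'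
    label₃-inj {j} {j'} {q} {q'} eq eq' = unique eq (proj₂ (label₃ j q))
      (trans (proj₂ (label₃ j' q')) (cong inj₂ (sym eq')))
      where
      unique : ∀ {s s' p} → s ≡ s' →
        from (proj₁ (columns s)) j ≡ inj₂ p → from (proj₁ (columns s')) j' ≡ inj₂ p → j ≡ j'
      unique {s} refl eq₁ eq₂ = from-injective (proj₁ (columns s)) (trans eq₁ (sym eq₂))

    module K₃ = Colouring (colouring AB↔Fin (↔-id B) _≟ᴬᴮ_ X₃ X₃-inj (λ j q → proj₁ (label₃ j q)) label₃-inj)

    I : Set
    I = (A ⊎ B) ⊎ C

    blockAA : A → D → I
    blockAA i (inG x) = inj₁ (inj₁ (σ.op i (inG x)))
    blockAA i (inE q) = inj₁ (inj₂ (ρ₁ i (inj₁ q)))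
    blockAA i (inC k) = inj₂ k

    blocks : Blocks A B C
    blocks = record
      { rowA = λ where
          i (inj₁ (inj₁ j)) → blockAA i (col.ldiv i j)
          i (inj₁ (inj₂ p)) → inj₁ (X₂ i (to (K₂.bij i) p))
          i (inj₂ k)        → inj₁ (inj₁ (σ.op i (inC k)))
      ; rowB = λ p j → X₃ j (to (K₃.bij j) p)
      ; rowC = λ k j → τ.op j (inC k)
      }
    open Blocks blocks

    private
      locateA : A → D → I
      locateA i (inG x) = inj₁ (inj₁ (col.op i (inG x)))
      locateA i (inE q) = inj₁ (inj₂ (ρ₂ i (inj₁ q)))
      locateA i (inC k) = inj₂ k

      -- Rows of `A` and columns of `A` and `B` are shown injective by left inverses: this one finds
      -- the column of a symbol in row `i`; `rowOfA` and `rowOfB` find its row in a column.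
      locate : A → I → I
      locate i (inj₁ (inj₁ s)) = locateA i (σ.ldiv i s)
      locate i (inj₁ (inj₂ k)) = inj₁ (occurrence-in-row i (to (K₁.bij i) k))
      locate i (inj₂ k)        = inj₁ (inj₁ (col.op i (inC k)))

      locate-blockAA : ∀ i d → locate i (blockAA i d) ≡ inj₁ (inj₁ (col.op i d))
      locate-blockAA i (inG x) = cong (locateA i) (σ.ldiv-op i (inG x))
      locate-blockAA i (inE q) = cong (inj₁ ∘ occurrence-in-row i) (strictlyInverseˡ (K₁.bij i) (inj₁ q))
      locate-blockAA i (inC k) = refl

      locate-X₂ : ∀ i d → locate i (inj₁ (X₂ i d)) ≡ inj₁ (inj₂ (ρ₂ i d))
      locate-X₂ i (inj₁ q) = cong (locateA i) (σ.ldiv-op i (inE q))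
      locate-X₂ i (inj₂ t) = cong (inj₁ ∘ occurrence-in-row i) (strictlyInverseˡ (K₁.bij i) (inj₂ t))

      locate-rowA : ∀ i x → locate i (rowA i x) ≡ x
      locate-rowA i (inj₁ (inj₁ j)) = trans (locate-blockAA i _) (cong (inj₁ ∘ inj₁) (col.op-ldiv i j))
      locate-rowA i (inj₁ (inj₂ p)) = trans (locate-X₂ i _) (cong (inj₁ ∘ inj₂) (strictlyInverseʳ (K₂.bij i) p))
      locate-rowA i (inj₂ k)        = cong (locateA i) (σ.ldiv-op i (inC k))

    filling : Filling A B C
    filling = record
      { blocks = blocks
      ; rowA-inj = λ i → left-inverse⇒injective (locate i) (locate-rowA i)
      ; rowB-inj = λ p → K₃.distinct p
      ; rowC-inj = λ k → τ.op-injʳ (inC k)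
      ; columnA-inj = λ j → left-inverse⇒injective (rowOfA j) (rowOfA-columnA j)
      ; columnB-inj = λ q → left-inverse⇒injective (rowOfB q) (rowOfB-columnB q)
      ; columnC-inj = λ k → σ.op-injʳ (inC k) ∘ inj₁-injective ∘ inj₁-injective
      }
      where
      slotA : A → D ⊎ B → I
      slotA j (inj₁ (inG x)) = inj₁ (inj₁ (col.rdiv (inG x) j))
      slotA j (inj₁ (inE q)) = inj₁ (inj₁ (col.rdiv (inE q) j))
      slotA j (inj₁ (inC k)) = inj₂ k
      slotA j (inj₂ x)       = inj₁ (inj₂ (from (K₃.bij (inj₁ j)) x))

      rowOfA : A → I → I
      rowOfA j (inj₁ s) = slotA j (from (proj₁ (symbols (inj₁ j))) s)
      rowOfA j (inj₂ k) = inj₁ (inj₁ (col.rdiv (inC k) j))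

      rowOfA-blockAA : ∀ i d → rowOfA (col.op i d) (blockAA i d) ≡ inj₁ (inj₁ i)
      -- `σ` placed this symbol by row; `agree` turns it into the one that `τ` records for the
      -- column.
      rowOfA-blockAA i (inG x) = trans
        (cong (slotA j) (trans (cong (from (proj₁ (symbols (inj₁ j))) ∘ inj₁) (sym (agree i x)))
                                (symbols⁻¹-used (inj₁ j) (inG x))))
        (cong (inj₁ ∘ inj₁) (col.rdiv-op (inG x) i))
        where j = col.op i (inG x)
      rowOfA-blockAA i (inE q) = trans
        (cong (slotA j) (trans (cong (λ i → from (proj₁ (symbols (inj₁ j))) (inj₂ (ρ₁ i (inj₁ q))))
                                      (sym (col.rdiv-op (inE q) i)))
                                (symbols⁻¹-used (inj₁ j) (inE q))))
        (cong (inj₁ ∘ inj₁) (col.rdiv-op (inE q) i))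
        where j = col.op i (inE q)
      rowOfA-blockAA i (inC k) = cong (inj₁ ∘ inj₁) (col.rdiv-op (inC k) i)

      rowOfA-columnA : ∀ j x → rowOfA j (columnA j x) ≡ x
      rowOfA-columnA j (inj₁ (inj₁ i)) =
        subst (λ j' → rowOfA j' (blockAA i (col.ldiv i j)) ≡ inj₁ (inj₁ i)) (col.op-ldiv i j)
          (rowOfA-blockAA i (col.ldiv i j))
      rowOfA-columnA j (inj₁ (inj₂ p)) =
        trans (cong (slotA j) (strictlyInverseʳ (proj₁ (symbols (inj₁ j))) _))
          (cong (inj₁ ∘ inj₂) (strictlyInverseʳ (K₃.bij (inj₁ j)) p))
      rowOfA-columnA j (inj₂ k) = cong (slotA j) (symbols⁻¹-used (inj₁ j) (inC k))

      slotB : B → A ⊎ B → A ⊎ B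
      slotB q (inj₁ i) = inj₁ i
      slotB q (inj₂ x) = inj₂ (from (K₃.bij (inj₂ q)) x)

      rowOfB : B → I → A ⊎ B
      rowOfB q (inj₁ s) = slotB q (from (proj₁ (symbols (inj₂ q))) s)
      rowOfB q (inj₂ k) = inj₂ q

      rowOfB-columnB : ∀ q x → rowOfB q (columnB q x) ≡ x
      rowOfB-columnB q (inj₁ i) = cong (slotB q) (symbols⁻¹-used (inj₂ q) i)
      rowOfB-columnB q (inj₂ p) =
        trans (cong (slotB q) (strictlyInverseʳ (proj₁ (symbols (inj₂ q))) _))
          (cong inj₂ (strictlyInverseʳ (K₃.bij (inj₂ q)) p))

-- Arithmetic modulo a and cyclic Latin squares.

%-injective-on-window : ∀ {u v} a .{{_ : NonZero a}} → u ≤ v → v < u + a → u % a ≡ v % a → u ≡ v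
%-injective-on-window {u} {v} a u≤v v<u+a eq with ℕₚ.m≤n⇒m<n∨m≡n (/-mono-≤ {o = a} u≤v ℕₚ.≤-refl)
... | inj₂ q≡q' = trans (m≡m%n+[m/n]*n u a)
        (trans (cong₂ (λ r q → r + q * a) eq q≡q') (sym (m≡m%n+[m/n]*n v a)))
... | inj₁ q<q' = contradiction v<u+a (ℕₚ.≤⇒≯ u+a≤v)
  where
  open ℕₚ.≤-Reasoning
  u+a≤v : u + a ≤ v
  u+a≤v = begin
    u + a                       ≡⟨ cong (_+ a) (m≡m%n+[m/n]*n u a) ⟩
    u % a + u / a * a + a       ≡⟨ ℕₚ.+-assoc (u % a) _ a ⟩
    u % a + (u / a * a + a)     ≡⟨ cong (u % a +_) (ℕₚ.+-comm _ a) ⟩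
    u % a + suc (u / a) * a     ≤⟨ ℕₚ.+-monoʳ-≤ (u % a) (ℕₚ.*-monoˡ-≤ a q<q') ⟩
    u % a + v / a * a           ≡⟨ cong (_+ v / a * a) eq ⟩
    v % a + v / a * a           ≡⟨ m≡m%n+[m/n]*n v a ⟨
    v                           ∎

+-%-cancelˡ : ∀ n {x y} a .{{_ : NonZero a}} → x < a → y < a → (n + x) % a ≡ (n + y) % a → x ≡ y
+-%-cancelˡ n {x} {y} a x<a y<a eq with ℕₚ.≤-total x y
... | inj₁ x≤y = ℕₚ.+-cancelˡ-≡ n x y (%-injective-on-window a (ℕₚ.+-monoʳ-≤ n x≤y)
        (ℕₚ.<-≤-trans (ℕₚ.+-monoʳ-< n y<a) (ℕₚ.+-monoˡ-≤ a (ℕₚ.m≤m+n n x))) eq)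
... | inj₂ y≤x = sym (ℕₚ.+-cancelˡ-≡ n y x (%-injective-on-window a (ℕₚ.+-monoʳ-≤ n y≤x)
        (ℕₚ.<-≤-trans (ℕₚ.+-monoʳ-< n x<a) (ℕₚ.+-monoˡ-≤ a (ℕₚ.m≤m+n n y))) (sym eq)))

toℕ-mod : ∀ n a .{{_ : NonZero a}} → toℕ (n mod a) ≡ n % a
toℕ-mod n a = toℕ-fromℕ< (m%n<n n a)

mod-injective : ∀ u v a .{{_ : NonZero a}} → u mod a ≡ v mod a → u % a ≡ v % a
mod-injective u v a eq = trans (sym (toℕ-mod u a)) (trans (cong toℕ eq) (toℕ-mod v a))

module Cyclic (a : ℕ) .{{_ : NonZero a}} where

  _⊕_ : Fin a → Fin a → Fin a
  x ⊕ y = (toℕ x + toℕ y) mod a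

  ⊕-cancelˡ : ∀ x → Inj (x ⊕_)
  ⊕-cancelˡ x {y} {z} eq = toℕ-injective
    (+-%-cancelˡ (toℕ x) a (toℕ<n y) (toℕ<n z) (mod-injective _ _ a eq))

  ⊕-comm : ∀ x y → x ⊕ y ≡ y ⊕ x
  ⊕-comm x y = cong (_mod a) (ℕₚ.+-comm (toℕ x) (toℕ y))

  ⊕-cancelʳ : ∀ y → Inj (_⊕ y)
  ⊕-cancelʳ y {x} {z} eq = ⊕-cancelˡ y (trans (⊕-comm y x) (trans eq (⊕-comm z y)))

  ⊕-assoc : ∀ x y z → (x ⊕ y) ⊕ z ≡ x ⊕ (y ⊕ z)
  ⊕-assoc x y z = toℕ-injective (trans (toℕ-mod _ a) (trans lemma (sym (toℕ-mod _ a))))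
    where
    open ≡-Reasoning
    X = toℕ x ; Y = toℕ y ; Z = toℕ z
    absorb : ∀ m n → (m % a + n) % a ≡ (m + n) % a
    absorb m n = trans (%-distribˡ-+ (m % a) n a)
      (trans (cong (λ r → (r + n % a) % a) (m%n%n≡m%n m a)) (sym (%-distribˡ-+ m n a)))
    lemma : (toℕ (x ⊕ y) + Z) % a ≡ (X + toℕ (y ⊕ z)) % a
    lemma = begin
      (toℕ (x ⊕ y) + Z) % a   ≡⟨ cong (λ r → (r + Z) % a) (toℕ-mod (X + Y) a) ⟩
      ((X + Y) % a + Z) % a   ≡⟨ absorb (X + Y) Z ⟩
      (X + Y + Z) % a         ≡⟨ cong (_% a) (trans (ℕₚ.+-assoc X Y Z) (ℕₚ.+-comm X (Y + Z))) ⟩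
      (Y + Z + X) % a         ≡⟨ absorb (Y + Z) X ⟨
      ((Y + Z) % a + X) % a   ≡⟨ cong (_% a) (ℕₚ.+-comm _ X) ⟩
      (X + (Y + Z) % a) % a   ≡⟨ cong (λ r → (X + r) % a) (toℕ-mod (Y + Z) a) ⟨
      (X + toℕ (y ⊕ z)) % a   ∎

  -- The Cayley table of ℤ/a with columns renamed by `θ`; the three squares of the construction
  -- differ only in `θ`.
  cyclicSquare : {D : Set} → D ↔ Fin a → LatinSquare (Fin a) D
  cyclicSquare {D} θ = record
    { op = op
    ; op-injˡ = injˡ
    ; op-injʳ = injʳ
    ; ldiv = λ i → from (proj₁ (bijˡ i))
    ; rdiv = λ d → from (proj₁ (bijʳ d))
    ; op-ldiv = λ i j → trans (sym (proj₂ (bijˡ i) _)) (strictlyInverseˡ (proj₁ (bijˡ i)) j)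
    ; op-rdiv = λ d j → trans (sym (proj₂ (bijʳ d) _)) (strictlyInverseˡ (proj₁ (bijʳ d)) j)
    }
    where
    op = λ i d → i ⊕ to θ d
    injˡ : ∀ i → Inj (op i)
    injˡ i = to-injective θ ∘ ⊕-cancelˡ i
    injʳ : ∀ d → Inj (λ i → op i d)
    injʳ d = ⊕-cancelʳ (to θ d)
    bijˡ = λ i → injective⇒↔ θ (↔-id _) (op i) (injˡ i)
    bijʳ = λ d → injective⇒↔ (↔-id (Fin a)) (↔-id _) (λ i → op i d) (injʳ d)

-- A near-complete mapping of the cyclic group.

halves : ∀ a → ∃₂ λ h p → p ≤ 1 × suc a ≡ h + h + p
halves zero          = 0 , 1 , s≤s z≤n , refl
halves (suc zero)    = 1 , 0 , z≤n , refl
halves (suc (suc a)) with halves a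
... | h , p , p≤1 , eq = suc h , p , p≤1 , trans (cong (2 +_) eq) (cong (λ n → suc (n + p)) (sym (ℕₚ.+-suc h h)))

-- A near-complete mapping of ℤ/a: on the first a − 1 residues both d ↦ w d and
-- d ↦ d + w d are injective modulo a (for even a no such w exists on all residues).
module NearComplete (a : ℕ) where

  h = proj₁ (halves a)
  p = proj₁ (proj₂ (halves a))
  p≤1 = proj₁ (proj₂ (proj₂ (halves a)))
  1+a≡ : suc a ≡ h + h + p
  1+a≡ = proj₂ (proj₂ (proj₂ (halves a)))

  data Half : ℕ → Set where
    low  : ∀ d → d < h → Half d
    high : ∀ t → Half (h + t)

  half : ∀ d → Half d
  half d with d <? h
  ... | yes d<h = low d d<h
  ... | no  d≮h = subst Half (ℕₚ.m+[n∸m]≡n (ℕₚ.≮⇒≥ d≮h)) (high (d ∸ h))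

  -- `p` is 1 for even a and 0 for odd a. `v` is even on the low half and odd on the high half, so
  -- the halves cannot collide; `w` is the identity except that for even a it skips the residue `h`.
  w v : ∀ {d} → Half d → ℕ
  w (low d _) = d
  w (high t)  = h + t + p
  v (low d _) = d + d
  v (high t)  = suc (t + t)

  d+w≡v : ∀ {d} (H : Half d) → d + w H ≡ v H ⊎ d + w H ≡ v H + a
  d+w≡v (low d _) = inj₁ refl
  d+w≡v (high t)  = inj₂ (trans (rearranged h t p) (trans (cong (t + t +_) (sym 1+a≡)) (ℕₚ.+-suc (t + t) a)))
    where
    rearranged : ∀ h t p → (h + t) + (h + t + p) ≡ t + t + (h + h + p)
    rearranged = solve-∀

  -- For even a the high half is shifted up by one, whence a hypothesis on `suc d` rather than `d`.
  w<a : ∀ {d} (H : Half d) → suc d < a → w H < a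
  w<a (low d _) d<a = ℕₚ.<⇒≤ d<a
  w<a (high t)  d<a = ℕₚ.≤-<-trans (ℕₚ.+-monoʳ-≤ (h + t) p≤1) (subst (_< a) (sym (ℕₚ.+-comm (h + t) 1)) d<a)

  v<a : ∀ {d} (H : Half d) → suc d < a → v H < a
  v<a (low d d<h) d<a = ℕₚ.≤-pred (ℕₚ.≤-trans (ℕₚ.≤-trans (s≤s (ℕₚ.≤-reflexive (sym (ℕₚ.+-suc d d)))) (ℕₚ.+-mono-≤ d<h d<h))
     (ℕₚ.≤-trans (ℕₚ.m≤m+n (h + h) p) (ℕₚ.≤-reflexive (sym 1+a≡))))
  -- Here `v` is `d + w` less a, and both summands are below a.
  v<a (high t)  d<a = ℕₚ.+-cancelʳ-< a _ a (begin-strict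
    suc (t + t) + a     ≡⟨ ℕₚ.+-suc (t + t) a ⟨
    t + t + suc a       ≡⟨ cong (t + t +_) 1+a≡ ⟩
    t + t + (h + h + p) ≡⟨ rearranged h t p ⟩
    (h + t) + (h + t + p) <⟨ ℕₚ.+-mono-< (ℕₚ.<⇒≤ d<a) (w<a (high t) d<a) ⟩
    a + a ∎)
    where
    open ℕₚ.≤-Reasoning
    rearranged : ∀ h t p → t + t + (h + h + p) ≡ (h + t) + (h + t + p)
    rearranged = solve-∀

  w-inj : ∀ {d d'} (H : Half d) (H' : Half d') → w H ≡ w H' → d ≡ d'
  w-inj (low d _)   (low d' _)   eq = eq
  w-inj (low d d<h) (high t)     eq = contradiction d<h (ℕₚ.≤⇒≯ (subst (h ≤_) (sym eq) (ℕₚ.≤-trans (ℕₚ.m≤m+n h t) (ℕₚ.m≤m+n (h + t) p))))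
  w-inj (high t)    (low d d<h)  eq = contradiction d<h (ℕₚ.≤⇒≯ (subst (h ≤_) eq (ℕₚ.≤-trans (ℕₚ.m≤m+n h t) (ℕₚ.m≤m+n (h + t) p))))
  w-inj (high t)    (high t')    eq = ℕₚ.+-cancelʳ-≡ p _ _ eq

  double-inj : ∀ m n → m + m ≡ n + n → m ≡ n
  double-inj zero    zero    _  = refl
  double-inj (suc m) (suc n) eq = cong suc (double-inj m n
    (ℕₚ.suc-injective (trans (sym (ℕₚ.+-suc m m)) (trans (ℕₚ.suc-injective eq) (ℕₚ.+-suc n n)))))

  even≢odd : ∀ m n → m + m ≢ suc (n + n)
  even≢odd (suc m) zero    eq with () ← trans (sym (ℕₚ.+-suc m m)) (ℕₚ.suc-injective eq)
  even≢odd (suc m) (suc n) eq = even≢odd m n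
    (ℕₚ.suc-injective (trans (sym (ℕₚ.+-suc m m)) (trans (ℕₚ.suc-injective eq) (cong suc (ℕₚ.+-suc n n)))))

  v-inj : ∀ {d d'} (H : Half d) (H' : Half d') → v H ≡ v H' → d ≡ d'
  v-inj (low d _) (low d' _) eq = double-inj d d' eq
  v-inj (low d _) (high t)   eq = contradiction eq (even≢odd d t)
  v-inj (high t)  (low d _)  eq = contradiction (sym eq) (even≢odd d t)
  v-inj (high t)  (high t')  eq = cong (h +_) (double-inj t t' (ℕₚ.suc-injective eq))

-- Cyclic dealing and the choice of the three squares.

record Spreading (a b f : ℕ) : Set where
  field
    spread level : Fin a → Fin f → Fin b
    spread-inj : ∀ i → Inj (spread i)
    level-inj  : ∀ {i i' t t'} → spread i t ≡ spread i' t' → level i t ≡ level i' t' → i ≡ i'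

-- Deal the a · f cells row by row to the b columns in cyclic order.
spreading : ∀ a b f → f ≤ b → a * f ≤ b * b → Spreading a b f
spreading a zero    zero z≤n _ = record
  { spread = λ _ () ; level = λ _ () ; spread-inj = λ { _ {()} } ; level-inj = λ { {t = ()} } }
spreading a b@(suc _) f f≤b af≤bb = record
  { spread = λ i t → cell i t mod b
  -- The quotient by b together with the remainder recovers the cell number, and `a * f ≤ b * b`
  -- keeps the quotient below b.
  ; level = λ i t → fromℕ< (cell/b< i t)
  ; spread-inj = row-inj
  ; level-inj = λ {i} {i'} {t} {t'} eq eq' → combine-injectiveˡ i t i' t' (toℕ-injective
      (trans (m≡m%n+[m/n]*n (cell i t) b) (trans
        (cong₂ (λ r q → r + q * b) (mod-injective (cell i t) (cell i' t') b eq)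
          (trans (sym (toℕ-fromℕ< (cell/b< i t))) (trans (cong toℕ eq') (toℕ-fromℕ< (cell/b< i' t')))))
        (sym (m≡m%n+[m/n]*n (cell i' t') b)))))
  }
  where
  cell : Fin a → Fin f → ℕ
  cell i t = toℕ (combine i t)
  cell/b< : ∀ i t → cell i t / b < b
  cell/b< i t = m<n*o⇒m/o<n (ℕₚ.<-≤-trans (toℕ<n (combine i t)) af≤bb)
  -- The cells of a row are f consecutive numbers, and f ≤ b.
  row-inj : ∀ i → Inj (λ t → cell i t mod b)
  row-inj i {t} {t'} eq = toℕ-injective (+-%-cancelˡ (f * toℕ i) b
    (ℕₚ.<-≤-trans (toℕ<n t) f≤b) (ℕₚ.<-≤-trans (toℕ<n t') f≤b)
    (trans (cong (_% b) (sym (toℕ-combine i t))) (trans (mod-injective (cell i t) (cell i t') b eq) (cong (_% b) (toℕ-combine i t')))))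

-- `C` is nonempty, so g < a and the G-diagonals fit into the first a - 1 residues, where the
-- near-complete mapping lives. With `col` at x, `τ` at w x and `σ` at v x, `agree` becomes x + w x
-- = v x in ℤ/a.
fillingFor : ∀ g e c f → (g + (e + suc c)) * f ≤ (e + f) * (e + f) →
  Filling (Fin (g + (e + suc c))) (Fin (e + f)) (Fin (suc c))
fillingFor g e c f af≤bb = filling (cyclicSquare D↔Fin) (cyclicSquare θσ) (cyclicSquare θτ) agree
    spread level spread-inj level-inj
  where
  open Construction g e (suc c) f
  a = g + (e + suc c)
  g<a : g < a
  g<a = ℕₚ.m<m+n g (subst (0 <_) (sym (ℕₚ.+-suc e c)) (s≤s z≤n))
  instance
    a≢0 : NonZero a
    a≢0 = >-nonZero (ℕₚ.≤-<-trans z≤n g<a)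
  open Cyclic a
  open NearComplete a
  open Spreading (spreading a (e + f) f (ℕₚ.m≤n+m f e) af≤bb)
  bound : (x : Fin g) → suc (toℕ x) < a
  bound x = ℕₚ.≤-<-trans (toℕ<n x) g<a
  vF wF : Fin g → Fin a
  vF x = fromℕ< (v<a (half (toℕ x)) (bound x))
  wF x = fromℕ< (w<a (half (toℕ x)) (bound x))
  vF-inj : Inj vF
  vF-inj {x} {y} eq = toℕ-injective (v-inj (half (toℕ x)) (half (toℕ y))
    (trans (sym (toℕ-fromℕ< _)) (trans (cong toℕ eq) (toℕ-fromℕ< _))))
  wF-inj : Inj wF
  wF-inj {x} {y} eq = toℕ-injective (w-inj (half (toℕ x)) (half (toℕ y))
    (trans (sym (toℕ-fromℕ< _)) (trans (cong toℕ eq) (toℕ-fromℕ< _))))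
  -- Only the G-diagonals are tied together, so any completion to a bijection serves.
  extend : (u : Fin g → Fin a) → Inj u → Σ (D ↔ Fin a) λ θ → ∀ x → to θ (inG x) ≡ u x
  extend u u-inj = proj₁ ext ↔-∘ (↔-id _ ⊎-↔ ↔-sym +↔⊎) , proj₂ ext
    where ext = extend-to-↔ (↔-id _) (↔-id _) u u-inj
  θσ = proj₁ (extend vF vF-inj)
  θτ = proj₁ (extend wF wF-inj)
  shift : ∀ x → to D↔Fin (inG x) ⊕ wF x ≡ vF x
  shift x = toℕ-injective (trans (toℕ-mod _ a) (trans
    (cong (_% a) (cong₂ _+_ (toℕ-↑ˡ x (e + suc c)) (toℕ-fromℕ< _))) (sym-v (d+w≡v H))))
    where
    H = half (toℕ x)
    v% : v H % a ≡ toℕ (vF x)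
    v% = trans (m<n⇒m%n≡m (v<a H (bound x))) (sym (toℕ-fromℕ< _))
    sym-v : ∀ {n} → n ≡ v H ⊎ n ≡ v H + a → n % a ≡ toℕ (vF x)
    sym-v (inj₁ eq) = trans (cong (_% a) eq) v%
    sym-v (inj₂ eq) = trans (cong (_% a) eq) (trans ([m+n]%n≡m%n (v H) a) v%)
  agree : ∀ i x → (i ⊕ to D↔Fin (inG x)) ⊕ to θτ (inG x) ≡ i ⊕ to θσ (inG x)
  agree i x = trans (⊕-assoc i _ _) (cong (i ⊕_) (trans
    (cong (to D↔Fin (inG x) ⊕_) (proj₂ (extend wF wF-inj) x))
    (trans (shift x) (sym (proj₂ (extend vF vF-inj) x)))))

-- Latin tableaux from bounded rows.

nth : List ℕ → ℕ → ℕ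
-- Length 0 beyond the last row turns `c < nth xs r` into a test for lying in the diagram.
nth []       _       = 0
nth (x ∷ xs) zero    = x
nth (x ∷ xs) (suc r) = nth xs r

∈-rowsFrom⁻ : ∀ s xs {r c} → (r , c) ∈ˡ rowsFrom s xs → ∃ λ r' → r ≡ s + r' × c < nth xs r'
∈-rowsFrom⁻ s (x ∷ xs) rc∈ with ∈-++⁻ (map (λ c → s , c) (upTo x)) rc∈
... | inj₁ here∈ with c , c∈ , refl ← ∈-map⁻ (s ,_) here∈ = 0 , sym (ℕₚ.+-identityʳ s) , ∈-upTo⁻ c∈
... | inj₂ later∈ with r' , eq , c< ← ∈-rowsFrom⁻ (suc s) xs later∈ = suc r' , trans eq (sym (ℕₚ.+-suc s r')) , c<

∈-cells⁻ : ∀ xs {r c} → (r , c) ∈cells xs → c < nth xs r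
∈-cells⁻ xs rc∈ with _ , refl , c< ← ∈-rowsFrom⁻ 0 xs rc∈ = c<

length-filter-unique : {X : Set} {P : X → Set} (P? : Decidable P) (f : ℕ → X) {n c : ℕ} →
  c < n → P (f c) → (∀ {c'} → c' < n → P (f c') → c' ≡ c) → length (filter P? (applyUpTo f n)) ≡ 1
length-filter-unique P? f {suc n} {zero} _ Pc unique
  rewrite filter-accept P? {f 0} {applyUpTo (f ∘ suc) n} Pc
  | filter-none P? (applyUpTo⁺₁ (f ∘ suc) n λ i<n Pi → contradiction (unique (s≤s i<n) Pi) λ ()) = refl
length-filter-unique P? f {suc n} {suc c} (s≤s c<n) Pc unique
  rewrite filter-reject P? {f 0} {applyUpTo (f ∘ suc) n} (λ P0 → contradiction (unique (s≤s z≤n) P0) λ ()) =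
  length-filter-unique P? (f ∘ suc) c<n Pc (λ c'<n Pc' → ℕₚ.suc-injective (unique (s≤s c'<n) Pc'))

-- After subtracting 1, the row is an injection of `Fin x` into itself.
row-surjective : ∀ {x} (f : ℕ → ℕ) → (∀ {c} → c < x → 1 ≤ f c × f c ≤ x) →
  (∀ {c c'} → c < x → c' < x → f c ≡ f c' → c ≡ c') →
  ∀ {i} → 1 ≤ i → i ≤ x → ∃ λ c → c < x × f c ≡ i
row-surjective {x} f range inj {suc i} _ i<x = toℕ (proj₁ hit) , toℕ<n (proj₁ hit) ,
    trans (sym (f≡ (proj₁ hit))) (cong suc (trans (cong toℕ (proj₂ hit)) (toℕ-fromℕ< i<x)))
  where
  pred< : ∀ {m} → 1 ≤ m × m ≤ x → pred m < x
  pred< (s≤s z≤n , m≤x) = m≤x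
  suc-pred : ∀ {m} → 1 ≤ m → suc (pred m) ≡ m
  suc-pred (s≤s z≤n) = refl
  F : Fin x → Fin x
  F c = fromℕ< (pred< (range (toℕ<n c)))
  f≡ : ∀ c → suc (toℕ (F c)) ≡ f (toℕ c)
  f≡ c = trans (cong suc (toℕ-fromℕ< (pred< (range (toℕ<n c))))) (suc-pred (proj₁ (range (toℕ<n c))))
  hit = endo-surjective F
    (λ {c} {c'} eq → toℕ-injective (inj (toℕ<n c) (toℕ<n c')
      (trans (sym (f≡ c)) (trans (cong (suc ∘ toℕ) eq) (f≡ c')))))
    (fromℕ< i<x)

-- `s` counts the rows already stripped off, since `T` keeps its row numbers during the recursion.
RowsInRange : ℕ → List ℕ → Tableau → Set
RowsInRange s xs T =
  (∀ r {c} → c < nth xs r → 1 ≤ T (r + s) c × T (r + s) c ≤ nth xs r) ×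
  (∀ r {c c'} → c < nth xs r → c' < nth xs r → T (r + s) c ≡ T (r + s) c' → c ≡ c')

rows-in-range-tail : ∀ s x xs T → RowsInRange s (x ∷ xs) T → RowsInRange (suc s) xs T
rows-in-range-tail s x xs T (range , inj) = range' , inj'
  where
  range' : ∀ r {c} → c < nth xs r → 1 ≤ T (r + suc s) c × T (r + suc s) c ≤ nth xs r
  range' r rewrite ℕₚ.+-suc r s = range (suc r)
  inj' : ∀ r {c c'} → c < nth xs r → c' < nth xs r → T (r + suc s) c ≡ T (r + suc s) c' → c ≡ c'
  inj' r rewrite ℕₚ.+-suc r s = inj (suc r)

count-entries : ∀ s xs T → RowsInRange s xs T → ∀ i → 1 ≤ i →
  length (filter (λ rc → T (proj₁ rc) (proj₂ rc) ≟ i) (rowsFrom s xs)) ≡ conjPart xs i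
count-entries s []       T _  i _   = refl
count-entries s (x ∷ xs) T rs@(range , inj) i 1≤i = begin
  length (filter P? (firstRow ++ rowsFrom (suc s) xs))
    ≡⟨ cong length (filter-++ P? firstRow (rowsFrom (suc s) xs)) ⟩
  length (filter P? firstRow ++ filter P? (rowsFrom (suc s) xs))
    ≡⟨ length-++ (filter P? firstRow) ⟩
  length (filter P? firstRow) + length (filter P? (rowsFrom (suc s) xs))
    ≡⟨ cong₂ (λ ys n → length (filter P? ys) + n) (map-applyUpTo id (s ,_) x)
         (count-entries (suc s) xs T (rows-in-range-tail s x xs T rs) i 1≤i) ⟩
  length (filter P? (applyUpTo (s ,_) x)) + conjPart xs i
    ≡⟨ first (i ≤? x) ⟩
  conjPart (x ∷ xs) i ∎
  where
  open ≡-Reasoning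
  P? = λ (rc : ℕ × ℕ) → T (proj₁ rc) (proj₂ rc) ≟ i
  firstRow = map (s ,_) (upTo x)
  first : Dec (i ≤ x) → length (filter P? (applyUpTo (s ,_) x)) + conjPart xs i ≡ conjPart (x ∷ xs) i
  first (yes i≤x) with c , c< , eq ← row-surjective (T s) (range 0) (inj 0) 1≤i i≤x = trans
    (cong (_+ conjPart xs i)
      (length-filter-unique P? (s ,_) c< eq (λ c'< eq' → inj 0 c'< c< (trans eq' (sym eq)))))
    (sym (cong length (filter-accept (i ≤?_) i≤x)))
  first (no i≰x) = trans
    (cong (λ ys → length ys + conjPart xs i) (filter-none P? (applyUpTo⁺₁ (s ,_) x
      (λ c< eq → i≰x (subst (_≤ x) eq (proj₂ (range 0 c<)))))))
    (sym (cong length (filter-reject (i ≤?_) i≰x)))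

-- Entries bounded by the row length make every row a permutation of 1, …, λ_r, so
-- that i occurs exactly once in each row of length ≥ i.
latin-criterion : ∀ xs T →
  (∀ r {c} → c < nth xs r → 1 ≤ T r c × T r c ≤ nth xs r) →
  (∀ r {c c'} → c < nth xs r → c' < nth xs r → T r c ≡ T r c' → c ≡ c') →
  (∀ {r r'} c → c < nth xs r → c < nth xs r' → T r c ≡ T r' c → r ≡ r') →
  IsLatinTableau xs T
latin-criterion xs T range row-inj col-inj =
    (λ r c rc∈ → proj₁ (range r (∈-cells⁻ xs rc∈)))
  , (λ r c c' rc∈ rc'∈ c≢c' eq → c≢c' (row-inj r (∈-cells⁻ xs rc∈) (∈-cells⁻ xs rc'∈) eq))
  , (λ r r' c rc∈ r'c∈ r≢r' eq → r≢r' (col-inj c (∈-cells⁻ xs rc∈) (∈-cells⁻ xs r'c∈) eq))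
  , count-entries 0 xs T (range₀ , row-inj₀)
  where
  range₀ : ∀ r {c} → c < nth xs r → 1 ≤ T (r + 0) c × T (r + 0) c ≤ nth xs r
  range₀ r rewrite ℕₚ.+-identityʳ r = range r
  row-inj₀ : ∀ r {c c'} → c < nth xs r → c' < nth xs r → T (r + 0) c ≡ T (r + 0) c' → c ≡ c'
  row-inj₀ r rewrite ℕₚ.+-identityʳ r = row-inj r

-- The tableau of a filling.

shape : ℕ → ℕ → ℕ → List ℕ
shape a b c = replicate a (a + b + c) ++ replicate b (a + b) ++ replicate c a

nth-< : ∀ m {x xs r} → r < m → nth (replicate m x ++ xs) r ≡ x
nth-< (suc m) {r = zero}  _         = refl
nth-< (suc m) {r = suc r} (s≤s r<m) = nth-< m r<m

nth-+ : ∀ m {x xs} r → nth (replicate m x ++ xs) (m + r) ≡ nth xs r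
nth-+ zero    r = refl
nth-+ (suc m) r = nth-+ m r

nth-≥length : ∀ xs {r} → length xs ≤ r → nth xs r ≡ 0
nth-≥length []       _         = refl
nth-≥length (x ∷ xs) (s≤s len) = nth-≥length xs len

module _ {a b c : ℕ} (F : Filling (Fin a) (Fin b) (Fin c)) where

  open Filling F

  private
    I : Set
    I = (Fin a ⊎ Fin b) ⊎ Fin c

    enc₂ : Fin a ⊎ Fin b → ℕ
    enc₂ = toℕ ∘ join a b

    -- Codes follow the order A, B, C, so that the bound on the entries of a row amounts to the
    -- codomains chosen in `Blocks`.
    I↔Fin : I ↔ Fin (a + b + c)
    I↔Fin = ↔-sym +↔⊎ ↔-∘ (↔-sym +↔⊎ ⊎-↔ ↔-id _)

    enc : I → ℕ
    enc = toℕ ∘ to I↔Fin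

    enc-inj : Inj enc
    enc-inj = to-injective I↔Fin ∘ toℕ-injective

    enc-AB : ∀ z → enc (inj₁ z) ≡ enc₂ z
    enc-AB z = toℕ-↑ˡ (join a b z) c

    enc-A : ∀ i → enc (inj₁ (inj₁ i)) ≡ toℕ i
    enc-A i = trans (enc-AB (inj₁ i)) (toℕ-↑ˡ i b)

    enc-B : ∀ p → enc (inj₁ (inj₂ p)) ≡ a + toℕ p
    enc-B p = trans (enc-AB (inj₂ p)) (toℕ-↑ʳ a p)

    enc-C : ∀ k → enc (inj₂ k) ≡ a + (b + toℕ k)
    enc-C k = trans (toℕ-↑ʳ (a + b) k) (ℕₚ.+-assoc a b (toℕ k))

    unenc : ∀ {r} → r < a + b + c → ∃ λ x → r ≡ enc x
    unenc r<n = from I↔Fin (fromℕ< r<n) ,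
      sym (trans (cong toℕ (strictlyInverseˡ I↔Fin (fromℕ< r<n))) (toℕ-fromℕ< r<n))

    decode : ℕ → Maybe I
    decode r with r <? a + b + c
    ... | yes r<n = just (from I↔Fin (fromℕ< r<n))
    ... | no  _   = nothing

    decode-enc : ∀ x → decode (enc x) ≡ just x
    decode-enc x with enc x <? a + b + c
    ... | yes r<n = cong just (trans (cong (from I↔Fin) (fromℕ<-toℕ (to I↔Fin x) r<n)) (strictlyInverseʳ I↔Fin x))
    ... | no ¬r<n = contradiction (toℕ<n (to I↔Fin x)) ¬r<n

    data Cell : I → I → Set where
      cellA : ∀ i y → Cell (inj₁ (inj₁ i)) y
      cellB : ∀ p z → Cell (inj₁ (inj₂ p)) (inj₁ z)
      cellC : ∀ k j → Cell (inj₂ k) (inj₁ (inj₁ j))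

    width : I → ℕ
    width (inj₁ (inj₁ i)) = a + b + c
    width (inj₁ (inj₂ p)) = a + b
    width (inj₂ k)        = a

    nth-shape : ∀ x → nth (shape a b c) (enc x) ≡ width x
    nth-shape (inj₁ (inj₁ i)) rewrite enc-A i = nth-< a (toℕ<n i)
    nth-shape (inj₁ (inj₂ p)) rewrite enc-B p = trans (nth-+ a (toℕ p)) (nth-< b (toℕ<n p))
    nth-shape (inj₂ k)        rewrite enc-C k = trans (nth-+ a (b + toℕ k)) (trans (nth-+ b (toℕ k)) (nth-replicate (toℕ<n k)))
      where
      nth-replicate : ∀ {c r} → r < c → nth (replicate c a) r ≡ a
      nth-replicate {suc c} {zero}  _         = refl
      nth-replicate {suc c} {suc r} (s≤s r<c) = nth-replicate r<c

    length-shape : length (shape a b c) ≡ a + b + c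
    length-shape = trans (length-++ (replicate a _)) (trans
      (cong₂ _+_ (length-replicate a) (trans (length-++ (replicate b _)) (cong₂ _+_ (length-replicate b) (length-replicate c))))
      (sym (ℕₚ.+-assoc a b c)))

    column : ∀ x {s} → s < width x → ∃ λ y → s ≡ enc y × Cell x y
    column (inj₁ (inj₁ i)) s<n with y , eq ← unenc s<n = y , eq , cellA i y
    column (inj₁ (inj₂ p)) s<a+b = inj₁ z , sym (trans (enc-AB z) (trans (cong toℕ (join-splitAt a b (fromℕ< s<a+b))) (toℕ-fromℕ< s<a+b))) , cellB p z
      where z = splitAt a (fromℕ< s<a+b)
    column (inj₂ k) s<a = inj₁ (inj₁ (fromℕ< s<a)) , sym (trans (enc-A (fromℕ< s<a)) (toℕ-fromℕ< s<a)) , cellC k _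

    row : ∀ r {s} → s < nth (shape a b c) r → ∃ λ x → r ≡ enc x
    row r s<len = unenc (subst (r <_) length-shape (ℕₚ.≰⇒> λ len≤r →
      contradiction (subst (_ <_) (nth-≥length (shape a b c) len≤r) s<len) λ ()))

    column-in-row : ∀ x {s} → s < nth (shape a b c) (enc x) → ∃ λ y → s ≡ enc y × Cell x y
    column-in-row x {s} s<len = column x (subst (s <_) (nth-shape x) s<len)

    entry : I → I → I
    entry (inj₁ (inj₁ i)) y               = rowA i y
    entry (inj₁ (inj₂ p)) (inj₁ z)        = inj₁ (rowB p z)
    entry (inj₂ k)        (inj₁ (inj₁ j)) = inj₁ (inj₁ (rowC k j))
    -- A default outside the diagram.
    entry _               y               = y

    entry-range : ∀ {x y} → Cell x y → enc (entry x y) < width x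
    entry-range (cellA i y) = toℕ<n (to I↔Fin (rowA i y))
    entry-range (cellB p z) = subst (_< a + b) (sym (enc-AB (rowB p z))) (toℕ<n (join a b (rowB p z)))
    entry-range (cellC k j) = subst (_< a) (sym (enc-A (rowC k j))) (toℕ<n (rowC k j))

    entry-row-inj : ∀ {x y y'} → Cell x y → Cell x y' → entry x y ≡ entry x y' → y ≡ y'
    entry-row-inj (cellA i _) (cellA .i _) eq = rowA-inj i eq
    entry-row-inj (cellB p _) (cellB .p _) eq = cong inj₁ (rowB-inj p (inj₁-injective eq))
    entry-row-inj (cellC k _) (cellC .k _) eq = cong (inj₁ ∘ inj₁) (rowC-inj k (inj₁-injective (inj₁-injective eq)))

    entry-columnA : ∀ j x → entry x (inj₁ (inj₁ j)) ≡ columnA j x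
    entry-columnA j (inj₁ (inj₁ i)) = refl
    entry-columnA j (inj₁ (inj₂ p)) = refl
    entry-columnA j (inj₂ k)        = refl

    entry-column-inj : ∀ {x x' y} → Cell x y → Cell x' y → entry x y ≡ entry x' y → x ≡ x'
    entry-column-inj {x} {x'} {inj₁ (inj₁ j)} _ _ eq =
      columnA-inj j (trans (sym (entry-columnA j x)) (trans eq (entry-columnA j x')))
    entry-column-inj {y = inj₁ (inj₂ q)} (cellA i _) (cellA i' _) eq = cong inj₁ (columnB-inj q {inj₁ i} {inj₁ i'} eq)
    entry-column-inj {y = inj₁ (inj₂ q)} (cellA i _) (cellB p' _) eq = cong inj₁ (columnB-inj q {inj₁ i} {inj₂ p'} eq)
    entry-column-inj {y = inj₁ (inj₂ q)} (cellB p _) (cellA i' _) eq = cong inj₁ (columnB-inj q {inj₂ p} {inj₁ i'} eq)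
    entry-column-inj {y = inj₁ (inj₂ q)} (cellB p _) (cellB p' _) eq = cong inj₁ (columnB-inj q {inj₂ p} {inj₂ p'} eq)
    entry-column-inj {y = inj₂ k} (cellA i _) (cellA i' _) eq = cong (inj₁ ∘ inj₁) (columnC-inj k eq)

    lookupEntry : Maybe I → Maybe I → ℕ
    -- Codes start at 0 and entries at 1: a code below the row length becomes an entry at most the
    -- row length.
    lookupEntry (just x) (just y) = suc (enc (entry x y))
    lookupEntry _        _        = 0

    tableau : Tableau
    tableau r s = lookupEntry (decode r) (decode s)

    tableau-enc : ∀ x y → tableau (enc x) (enc y) ≡ suc (enc (entry x y))
    tableau-enc x y = cong₂ lookupEntry (decode-enc x) (decode-enc y)

    entries-equal : ∀ x y x' y' → tableau (enc x) (enc y) ≡ tableau (enc x') (enc y') → entry x y ≡ entry x' y'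
    entries-equal x y x' y' eq = enc-inj (ℕₚ.suc-injective (trans (sym (tableau-enc x y)) (trans eq (tableau-enc x' y'))))

    range : ∀ r {s} → s < nth (shape a b c) r → 1 ≤ tableau r s × tableau r s ≤ nth (shape a b c) r
    range r s< with row r s<
    ... | x , refl with column-in-row x s<
    ...   | y , refl , cell rewrite tableau-enc x y | nth-shape x = s≤s z≤n , entry-range cell

    rows-distinct : ∀ r {s s'} → s < nth (shape a b c) r → s' < nth (shape a b c) r →
      tableau r s ≡ tableau r s' → s ≡ s'
    rows-distinct r s< s'< eq with row r s<
    ... | x , refl with column-in-row x s< | column-in-row x s'<
    ...   | y , refl , cell | y' , refl , cell' = cong enc (entry-row-inj cell cell' (entries-equal x y x y' eq))

    columns-distinct : ∀ {r r'} s → s < nth (shape a b c) r → s < nth (shape a b c) r' →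
      tableau r s ≡ tableau r' s → r ≡ r'
    columns-distinct {r} {r'} s s< s<' eq with row r s< | row r' s<'
    ... | x , refl | x' , refl with column-in-row x s< | column-in-row x' s<'
    ...   | y , refl , cell | y' , eq' , cell' with refl ← enc-inj {y} {y'} eq' =
            cong enc (entry-column-inj cell cell' (entries-equal x y x' y eq))

  shape-latin : Latin (shape a b c)
  shape-latin = tableau , latin-criterion (shape a b c) tableau range rows-distinct columns-distinct

-- The square case and the choice of parameters.

squareFilling : ∀ a → Filling (Fin a) (Fin 0) (Fin 0)
squareFilling a = record
  { blocks = record { rowA = rowA ; rowB = λ () ; rowC = λ () }
  ; rowA-inj = rowA-inj
  ; rowB-inj = λ ()
  ; rowC-inj = λ ()
  ; columnA-inj = columnA-inj
  ; columnB-inj = λ ()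
  ; columnC-inj = λ ()
  }
  where
  nonZero : ∀ {n} → Fin n → NonZero n
  nonZero {suc n} _ = _
  add : Fin a → Fin a → Fin a
  add i j = Cyclic._⊕_ a {{nonZero i}} i j
  rowA : Fin a → (Fin a ⊎ Fin 0) ⊎ Fin 0 → (Fin a ⊎ Fin 0) ⊎ Fin 0
  rowA i (inj₁ (inj₁ j)) = inj₁ (inj₁ (add i j))
  rowA-inj : ∀ i → Inj (rowA i)
  rowA-inj i {inj₁ (inj₁ j)} {inj₁ (inj₁ j')} eq =
    cong (inj₁ ∘ inj₁) (Cyclic.⊕-cancelˡ a {{nonZero i}} i (inj₁-injective (inj₁-injective eq)))
  columnA-inj : ∀ j → Inj (Blocks.columnA (record { rowA = rowA ; rowB = λ () ; rowC = λ () }) j)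
  columnA-inj j {inj₁ (inj₁ i)} {inj₁ (inj₁ i')} eq =
    cong (inj₁ ∘ inj₁) (Cyclic.⊕-cancelʳ a {{nonZero j}} j (inj₁-injective (inj₁-injective eq)))

-- e, the number of B-symbols in each row of the block A × A, is min(b, a − c).
shape-latin-if : ∀ a b c → suc c ≤ a → a * (b + suc c) ≤ b * b + a * a → Latin (shape a b (suc c))
shape-latin-if a b c c<a wide with b + suc c ≤? a
-- Here e = b and f = 0: nothing is spread and the inequality is trivial.
... | yes b+c≤a = subst₂ (λ a b → Latin (shape a b (suc c))) (ℕₚ.m∸n+n≡m b+c≤a) (ℕₚ.+-identityʳ b)
        (shape-latin (fillingFor (a ∸ (b + suc c)) b c 0
          (subst (_≤ (b + 0) * (b + 0)) (sym (ℕₚ.*-zeroʳ (a ∸ (b + suc c) + (b + suc c)))) z≤n)))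
... | no b+c≰a = subst₂ (λ a b → Latin (shape a b (suc c))) a≡ b≡
        (shape-latin (fillingFor 0 e c f
          (subst₂ (λ a b → a * f ≤ b * b) (sym a≡) (sym b≡) af≤bb)))
  where
  e = a ∸ suc c
  f = b ∸ e
  a≡ : e + suc c ≡ a
  a≡ = ℕₚ.m∸n+n≡m c<a
  e≤b : e ≤ b
  e≤b = ℕₚ.+-cancelʳ-≤ (suc c) e b (subst (_≤ b + suc c) (sym a≡) (ℕₚ.<⇒≤ (ℕₚ.≰⇒> b+c≰a)))
  b≡ : e + f ≡ b
  b≡ = ℕₚ.m+[n∸m]≡n e≤b
  b+c≡ : b + suc c ≡ f + a
  b+c≡ = trans (cong (_+ suc c) (trans (sym b≡) (ℕₚ.+-comm e f))) (trans (ℕₚ.+-assoc f e (suc c)) (cong (f +_) a≡))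
  -- As b + suc c = f + a, cancelling a² in `wide` leaves exactly this.
  af≤bb : a * f ≤ b * b
  af≤bb = ℕₚ.+-cancelʳ-≤ (a * a) (a * f) (b * b)
    (subst (_≤ b * b + a * a) (trans (cong (a *_) b+c≡) (ℕₚ.*-distribˡ-+ a f a)) wide)

-- Conjugates, partial sums and the consequences of wideness.

conjPart-++ : ∀ xs ys i → conjPart (xs ++ ys) i ≡ conjPart xs i + conjPart ys i
conjPart-++ xs ys i = trans (cong length (filter-++ (i ≤?_) xs ys)) (length-++ (filter (i ≤?_) xs))

conjPart-all : ∀ {i xs} → All (i ≤_) xs → conjPart xs i ≡ length xs
conjPart-all all = cong length (filter-all (_ ≤?_) all)

conjPart-none : ∀ {i xs} → All (_< i) xs → conjPart xs i ≡ 0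
conjPart-none all = cong length (filter-none (_ ≤?_) (All.map ℕₚ.<⇒≱ all))

conjPart-all⁻ : ∀ {i xs} → conjPart xs i ≡ length xs → All (i ≤_) xs
conjPart-all⁻ {i} {xs} eq = subst (All (i ≤_)) (filter-complete (i ≤?_) eq) (all-filter (i ≤?_) xs)

length-conj : ∀ xs → length (conj xs) ≡ largest xs
length-conj xs = trans (length-map _ (upTo (largest xs))) (length-upTo (largest xs))

nth-applyUpTo : ∀ f n {i} → i < n → nth (applyUpTo f n) i ≡ f i
nth-applyUpTo f (suc n) {zero}  _         = refl
nth-applyUpTo f (suc n) {suc i} (s≤s i<n) = nth-applyUpTo (f ∘ suc) n i<n

self-conj-nth : ∀ xs → conj xs ≡ xs → ∀ {i} → i < length xs → nth xs i ≡ conjPart xs (suc i)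
self-conj-nth xs sc {i} i<len = trans (cong (λ ys → nth ys i) (trans (sym sc) (map-upTo _ (largest xs))))
  (nth-applyUpTo _ (largest xs) (subst (i <_) (trans (cong length (sym sc)) (length-conj xs)) i<len))

suffix-subpartition : ∀ xs {ys} → IsPartition (xs ++ ys) → IsSubpartition ys (xs ++ ys)
suffix-subpartition xs {ys} (linked , pos) = (linked-suffix xs linked , ++⁻ʳ xs pos) , λ v →
    ℕₚ.≤-trans (ℕₚ.m≤n+m (count v ys) (count v xs))
      (ℕₚ.≤-reflexive (sym (trans (cong length (filter-++ (_≟ v) xs ys)) (length-++ (filter (_≟ v) xs)))))
  where
  linked-suffix : ∀ xs {ys} → Linked _≥_ (xs ++ ys) → Linked _≥_ ys
  linked-suffix []       l = l
  linked-suffix (x ∷ xs) l = linked-suffix xs (Linked.tail l)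

largest-upper : ∀ xs → All (_≤ largest xs) xs
largest-upper []       = []
largest-upper (x ∷ xs) = ℕₚ.m≤m⊔n x (largest xs) ∷ All.map (λ y≤ → ℕₚ.≤-trans y≤ (ℕₚ.m≤n⊔m x (largest xs))) (largest-upper xs)

partialSum-conj-≥ : ∀ xs j m → j ≤ largest xs → (∀ {i} → i < j → m ≤ conjPart xs (suc i)) →
  j * m ≤ partialSum (conj xs) j
partialSum-conj-≥ xs j m j≤ m≤ =
  subst (λ ys → j * m ≤ partialSum ys j) (sym (map-upTo _ (largest xs))) (go _ j j≤ m≤)
  where
  go : ∀ f {n} j → j ≤ n → (∀ {i} → i < j → m ≤ f i) → j * m ≤ sum (take j (applyUpTo f n))
  go f zero    _         _  = z≤n
  go f (suc j) (s≤s j≤n) m≤ = ℕₚ.+-mono-≤ (m≤ (s≤s z≤n)) (go (f ∘ suc) j j≤n (m≤ ∘ s≤s))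

sum-take-≤ : ∀ {x} xs j → All (_≤ x) xs → sum (take j xs) ≤ j * x
sum-take-≤ xs       zero    _        = z≤n
sum-take-≤ []       (suc j) _        = z≤n
sum-take-≤ (y ∷ xs) (suc j) (y≤ ∷ p) = ℕₚ.+-mono-≤ y≤ (sum-take-≤ xs j p)

-- Each of the j parts is charged x, and each of the k large parts another y.
sum-take-replicate-++-≤ : ∀ {x} y k xs j → All (_≤ x) xs →
  sum (take j (replicate k (x + y) ++ xs)) ≤ k * y + j * x
sum-take-replicate-++-≤ y zero    xs j       p = sum-take-≤ xs j p
sum-take-replicate-++-≤ y (suc k) xs zero    p = z≤n
sum-take-replicate-++-≤ {x} y (suc k) xs (suc j) p = begin
  (x + y) + sum (take j (replicate k (x + y) ++ xs)) ≤⟨ ℕₚ.+-monoʳ-≤ (x + y) (sum-take-replicate-++-≤ y k xs j p) ⟩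
  (x + y) + (k * y + j * x)                          ≡⟨ rearranged x y (k * y) (j * x) ⟩
  (y + k * y) + (x + j * x)                          ∎
  where
  open ℕₚ.≤-Reasoning
  rearranged : ∀ x y u v → (x + y) + (u + v) ≡ (y + u) + (x + v)
  rearranged = solve-∀

module _ (a b c : ℕ) (0<a : 0 < a) (part : IsPartition (shape a b (suc c))) (wide : Wide (shape a b (suc c))) where

  private
    top = replicate a (a + b + suc c)
    mid = replicate b (a + b)
    low = replicate (suc c) a

  -- Dominance for the subpartition `low` at j = 1: its first part a against its number of parts.
  wide⇒c≤a : suc c ≤ a
  wide⇒c≤a = begin
    suc c                   ≡⟨ ℕₚ.*-identityˡ (suc c) ⟨
    1 * suc c               ≤⟨ partialSum-conj-≥ low 1 (suc c) (ℕₚ.≤-trans 0<a (All.head (largest-upper low)))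
                                 (λ { (s≤s z≤n) → ℕₚ.≤-reflexive (sym (trans (conjPart-all (replicate⁺ (suc c) 0<a)) (length-replicate (suc c)))) }) ⟩
    partialSum (conj low) 1 ≤⟨ wide low (subst (IsSubpartition low) assoc (suffix-subpartition (top ++ mid) (subst IsPartition (sym assoc) part))) 1 ⟩
    a + 0                   ≡⟨ ℕₚ.+-identityʳ a ⟩
    a                       ∎
    where
    open ℕₚ.≤-Reasoning
    assoc : (top ++ mid) ++ low ≡ shape a b (suc c)
    assoc = ++-assoc top mid low

  -- Dominance for `mid ++ low` at j = a: the first a conjugate parts all equal the number of parts,
  -- while among the first a parts at most b exceed a, each by b.
  wide⇒quadratic : a * (b + suc c) ≤ b * b + a * a
  wide⇒quadratic = begin
    a * (b + suc c)                  ≤⟨ partialSum-conj-≥ (mid ++ low) a (b + suc c) a≤largest rows ⟩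
    partialSum (conj (mid ++ low)) a ≤⟨ wide (mid ++ low) (suffix-subpartition top part) a ⟩
    partialSum (mid ++ low) a        ≤⟨ sum-take-replicate-++-≤ b b low a (replicate⁺ (suc c) ℕₚ.≤-refl) ⟩
    b * b + a * a                    ∎
    where
    open ℕₚ.≤-Reasoning
    a≤largest : a ≤ largest (mid ++ low)
    a≤largest = All.head (++⁻ʳ mid (largest-upper (mid ++ low)))
    rows : ∀ {i} → i < a → b + suc c ≤ conjPart (mid ++ low) (suc i)
    rows i<a = ℕₚ.≤-reflexive (sym (trans
      (conjPart-all (++⁺ (replicate⁺ b (ℕₚ.≤-trans i<a (ℕₚ.m≤m+n a b))) (replicate⁺ (suc c) i<a)))
      (trans (length-++ mid) (cong₂ _+_ (length-replicate b) (length-replicate (suc c))))))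

-- The shape of a self-conjugate partition.

module _ (p q r x y z : ℕ) (z<x : z < x) (z<y<x : q ≡ 0 ⊎ (z < y × y < x))
  (pos : All (0 <_) (replicate (suc p) x ++ replicate q y ++ replicate (suc r) z))
  (sc : conj (replicate (suc p) x ++ replicate q y ++ replicate (suc r) z)
        ≡ replicate (suc p) x ++ replicate q y ++ replicate (suc r) z) where

  private
    P = suc p
    R = suc r
    X = replicate P x
    Y = replicate q y
    Z = replicate R z
    L = X ++ Y ++ Z

    length-L : length L ≡ P + (q + R)
    length-L = trans (length-++ X) (cong₂ _+_ (length-replicate P)
      (trans (length-++ Y) (cong₂ _+_ (length-replicate q) (length-replicate R))))

    nth≡conjPart : ∀ {i} → i < P + (q + R) → nth L i ≡ conjPart L (suc i)
    nth≡conjPart {i} i< = self-conj-nth L sc (subst (i <_) (sym length-L) i<)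

    x≡length : x ≡ length L
    x≡length = trans (nth≡conjPart {0} (s≤s z≤n)) (conjPart-all pos)

    -- The P-th part x is the number of parts, so by self-conjugacy every part is at least P.
    P≤z : P ≤ z
    P≤z = All.head (++⁻ʳ Y (++⁻ʳ X (conjPart-all⁻ {P} {L}
      (trans (sym (nth≡conjPart {p} (ℕₚ.m≤m+n P (q + R)))) (trans (nth-< P {x} {Y ++ Z} ℕₚ.≤-refl) x≡length)))))

    P<length : P + 0 < P + (q + R)
    P<length = ℕₚ.+-monoʳ-< P (ℕₚ.≤-trans (s≤s z≤n) (ℕₚ.m≤n+m R q))

    conjPart-P+1 : conjPart L (suc P) ≡ nth (Y ++ Z) 0
    conjPart-P+1 = trans (cong (conjPart L ∘ suc) (sym (ℕₚ.+-identityʳ P)))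
      (trans (sym (nth≡conjPart P<length)) (nth-+ P 0))

    next<x : ∀ {q'} → q' ≡ 0 ⊎ (z < y × y < x) → nth (replicate q' y ++ Z) 0 < x
    next<x {zero}  _                = z<x
    next<x {suc _} (inj₂ (_ , y<x)) = y<x

    all-Y : ∀ {i q'} → q' ≡ 0 ⊎ (z < y × y < x) → i ≤ suc z → All (i ≤_) (replicate q' y)
    all-Y {q' = zero}   _                i≤ = []
    all-Y {q' = suc q'} (inj₂ (z<y , _)) i≤ = replicate⁺ (suc q') (ℕₚ.≤-trans i≤ z<y)

    -- If P < z, all parts would be at least P + 1, so the part numbered P + 1 would be x, but the
    -- run of x has ended.
    z≤P : z ≤ P
    z≤P = ℕₚ.≮⇒≥ λ P<z → ℕₚ.<-irrefl
      (trans (sym conjPart-P+1) (trans (conjPart-all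
        (++⁺ (replicate⁺ P (ℕₚ.≤-trans P<z (ℕₚ.<⇒≤ z<x)))
          (++⁺ (all-Y z<y<x (ℕₚ.m≤n⇒m≤1+n P<z)) (replicate⁺ R P<z)))) (sym x≡length)))
      (next<x z<y<x)

    z≡P : z ≡ P
    z≡P = ℕₚ.≤-antisym z≤P P≤z

    -- Only the runs `X` and `Y` exceed z = P. By self-conjugacy this count is the middle part size
    -- when q > 0; q = 0 covers two part sizes.
    conjPart-P+1≡ : conjPart L (suc P) ≡ P + q
    conjPart-P+1≡ = begin
      conjPart L (suc P)                               ≡⟨ conjPart-++ X (Y ++ Z) (suc P) ⟩
      conjPart X (suc P) + conjPart (Y ++ Z) (suc P)   ≡⟨ cong₂ _+_
        (trans (conjPart-all (replicate⁺ P P<x)) (length-replicate P))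
        (trans (conjPart-++ Y Z (suc P)) (cong₂ _+_
          (trans (conjPart-all (all-Y z<y<x (s≤s P≤z))) (length-replicate q))
          (conjPart-none (replicate⁺ R (s≤s z≤P))))) ⟩
      P + (q + 0)                                      ≡⟨ cong (P +_) (ℕₚ.+-identityʳ q) ⟩
      P + q                                            ∎
      where
      open ≡-Reasoning
      P<x = ℕₚ.≤-<-trans P≤z z<x

    Y≡ : ∀ {q'} → nth (replicate q' y ++ Z) 0 ≡ P + q → replicate q' y ≡ replicate q' (P + q)
    Y≡ {zero}   _  = refl
    Y≡ {suc q'} eq = cong (replicate (suc q')) eq

  self-conj-shape : L ≡ shape P q R
  self-conj-shape = cong₂ _++_
    (cong (replicate P) (trans x≡length (trans length-L (sym (ℕₚ.+-assoc P q R)))))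
    (cong₂ _++_ (Y≡ (trans (sym conjPart-P+1) conjPart-P+1≡)) (cong (replicate R) z≡P))

-- Splitting a partition into runs of equal parts.

first-run : ∀ x xs → Linked _≥_ (x ∷ xs) →
  ∃₂ λ p ys → x ∷ xs ≡ replicate (suc p) x ++ ys × All (_< x) ys × Linked _≥_ ys
first-run x []       _ = 0 , [] , refl , [] , []
first-run x (y ∷ ys) (x≥y ∷ l) with x ≟ y
... | yes refl with p , zs , eq , below , l' ← first-run x ys l = suc p , zs , cong (x ∷_) eq , below , l'
... | no x≢y = 0 , y ∷ ys , refl ,
      All.map (λ z≤y → ℕₚ.≤-<-trans z≤y (ℕₚ.≤∧≢⇒< x≥y (x≢y ∘ sym)))
        (Linked⇒All (flip ℕₚ.≤-trans) ℕₚ.≤-refl l) , l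

distinctParts-run : ∀ p x {ys} → All (_< x) ys →
  distinctParts (replicate (suc p) x ++ ys) ≡ suc (distinctParts ys)
distinctParts-run p x {ys} below = cong (suc ∘ length) (others p)
  where
  x? = λ y → ¬? (x ≟ y)
  others : ∀ p → filter x? (deduplicate _≟_ (replicate p x ++ ys)) ≡ deduplicate _≟_ ys
  others zero    = filter-all x? (deduplicate⁺ _≟_ (All.map (λ y<x x≡y → ℕₚ.<-irrefl (sym x≡y) y<x) below))
  others (suc p) = trans (filter-reject x? (λ x≢x → x≢x refl))
    (trans (filter-idem x? (deduplicate _≟_ (replicate p x ++ ys))) (others p))

runs-latin : ∀ p q r x y z → z < x → q ≡ 0 ⊎ (z < y × y < x) →
  let xs = replicate (suc p) x ++ replicate q y ++ replicate (suc r) z in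
  IsPartition xs → conj xs ≡ xs → Wide xs → Latin xs
runs-latin p q r x y z z<x z<y<x part sc wide = subst Latin (sym eq) (shape-latin-if (suc p) q r
    (wide⇒c≤a (suc p) q r (s≤s z≤n) part' wide') (wide⇒quadratic (suc p) q r (s≤s z≤n) part' wide'))
  where
  eq = self-conj-shape p q r x y z z<x z<y<x (proj₂ part) sc
  part' = subst IsPartition eq part
  wide' = subst Wide eq wide

-- The first conjugate part is the number of parts, so the diagram is a square.
one-run-latin : ∀ p x → conj (replicate (suc p) x) ≡ replicate (suc p) x → 0 < x → Latin (replicate (suc p) x)
one-run-latin p x sc 0<x = subst Latin eq (shape-latin (squareFilling (suc p)))
  where
  x≡ : x ≡ suc p
  x≡ = trans (self-conj-nth (replicate (suc p) x) sc (s≤s z≤n))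
    (trans (conjPart-all (replicate⁺ (suc p) 0<x)) (length-replicate (suc p)))
  eq : shape (suc p) 0 0 ≡ replicate (suc p) x
  eq = trans (++-identityʳ _) (cong (replicate (suc p))
    (trans (ℕₚ.+-identityʳ _) (trans (ℕₚ.+-identityʳ _) (sym x≡))))

SelfConjugateWide⇒Latin : List ℕ → Set
SelfConjugateWide⇒Latin xs = IsPartition xs → conj xs ≡ xs → Wide xs → Latin xs

three-runs : ∀ xs → Linked _≥_ xs → distinctParts xs ≤ 3 → SelfConjugateWide⇒Latin xs
three-runs [] _ _ _ _ _ = (λ _ _ → 0) , latin-criterion [] (λ _ _ → 0) (λ _ ()) (λ _ ()) (λ _ ())
three-runs (x ∷ xs) l ≤3 with first-run x xs l
... | p , [] , eq , _ , _ = subst SelfConjugateWide⇒Latin (sym (trans eq (++-identityʳ _)))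
        (λ part sc _ → one-run-latin p x sc (All.head (proj₂ part)))
... | p , y ∷ ys , eq , y<x ∷ ys<x , l' with first-run y ys l'
...   | q , [] , eq' , _ , _ = subst SelfConjugateWide⇒Latin
          (sym (trans eq (cong (replicate (suc p) x ++_) (trans eq' (++-identityʳ _)))))
          -- The second run takes the place of the smallest parts; the empty middle run gets the
          -- dummy size 0.
          (runs-latin p 0 q x 0 y y<x (inj₁ refl))
...   | q , z ∷ zs , eq' , z<y ∷ zs<y , l″ with first-run z zs l″
...     | r , [] , eq″ , _ , _ = subst SelfConjugateWide⇒Latin
            (sym (trans eq (cong (replicate (suc p) x ++_)
              (trans eq' (cong (replicate (suc q) y ++_) (trans eq″ (++-identityʳ _)))))))
            (runs-latin p (suc q) r x y z (ℕₚ.<-trans z<y y<x) (inj₂ (z<y , y<x)))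
...     | r , w ∷ ws , eq″ , below , _ = contradiction ≤3 (ℕₚ.<⇒≱ four)
  where
  four : 3 < distinctParts (x ∷ xs)
  four = ℕₚ.≤-trans (s≤s (s≤s (s≤s (s≤s z≤n)))) (ℕₚ.≤-reflexive (sym (begin
    distinctParts (x ∷ xs)                         ≡⟨ trans (cong distinctParts eq) (distinctParts-run p x (y<x ∷ ys<x)) ⟩
    suc (distinctParts (y ∷ ys))                   ≡⟨ cong suc (trans (cong distinctParts eq') (distinctParts-run q y (z<y ∷ zs<y))) ⟩
    suc (suc (distinctParts (z ∷ zs)))             ≡⟨ cong (2 +_) (trans (cong distinctParts eq″) (distinctParts-run r z below)) ⟩
    suc (suc (suc (distinctParts (w ∷ ws))))       ∎)))
    where open ≡-Reasoning

theorem5 : (λ₀ : List ℕ) → IsPartition λ₀ → conj λ₀ ≡ λ₀ → Wide λ₀ →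
    distinctParts λ₀ ≤ 3 → Latin λ₀
theorem5 λ₀ part sc wide ≤3 = three-runs λ₀ (proj₁ part) ≤3 part sc wide
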